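{- Let $n,k$ be positive integers. The multiplicative inverse function $f_{\mathrm{inv}}$ on $\mathbb F_{2^n}$ is not $k$th order sum-free if and only if there exist $u_1,\dots,u_k\in\mathbb F_{2^n}$ such that $\Delta(u_1,\dots,u_k)\ne 0$ but $\Theta_k(u_1,\dots,u_k)=0$.
   Context: $f_{\mathrm{inv}}(x)=x^{ -1}$ for $x\ne0$ and $f_{\mathrm{inv}}(0)=0$. A function $f:\mathbb F_{2^n}\to\mathbb F_{2^n}$ is $k$th order sum-free if $\sum_{x\in A}f(x)\ne 0$ for every $k$-dimensional $\mathbb F_2$-affine subspace $A$ of $\mathbb F_{2^n}$. $\Delta(X_1,\dots,X_k)=\det\bigl(X_j^{2^{i}}\bigr)_{0\le i\le k-1,\,1\le j\le k}\in\mathbb F_2[X_1,\dots,X_k]$ is the Moore determinant over $\mathbb F_2$. A $2$-adic partition is a partition all of whose parts are powers of $2$; $\Lambda_k$ is the set of $2$-adic partitions of $2^{k-1}$ with at most $k$ parts. For a partition $\lambda$ with at most $k$ parts, $m_\lambda(X_1,\dots,X_k)$ is the monomial symmetric polynomial (sum of all distinct monomials $X_1^{\alpha_1}\cdots X_k^{\alpha_k}$ where $(\alpha_1,\dots,\alpha_k)$ is a permutation of $\lambda$ padded with zeros). Define $\Theta_k=\sum_{\lambda\in\Lambda_k}m_\lambda(X_1,\dots,X_k)\in\mathbb F_2[X_1,\dots,X_k]$. -}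

module Defs where

open import Level using (0ℓ) renaming (suc to lsuc)
open import Algebra.Bundles using (CommutativeRing)
open import Data.Nat using (ℕ; zero; suc; _^_; _≡ᵇ_; _≤ᵇ_; _∸_)
open import Data.Bool using (Bool; true; false; if_then_else_; _∧_; not)
open import Data.Fin using (Fin; zero; suc; punchIn)
open import Data.Vec using (Vec; []; _∷_; lookup; toList)
open import Data.List using (List; []; _∷_; [_]; map; concatMap; upTo; filterᵇ; foldr; _++_; length)
open import Data.Bool.ListAction using (all; any)
open import Data.Product using (∃)
open import Relation.Binary.PropositionalEquality using (_≡_)
open import Relation.Nullary using (¬_; Dec; yes; no)

-- A finite field with exactly 2^n elements (any such field is F_{2^n};
-- all of them are isomorphic).  Underlying commutative ring from the
-- standard library, plus: decidable equality, 0 ≠ 1, inverses of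
-- nonzero elements, and a bijection (w.r.t. ≈) with Fin (2 ^ n).

record FiniteField (n : ℕ) : Set₁ where
  field
    cring : CommutativeRing 0ℓ 0ℓ
  open CommutativeRing cring public
  field
    _≟_     : (x y : Carrier) → Dec (x ≈ y)
    0≉1     : ¬ (0# ≈ 1#)
    inv     : (x : Carrier) → ¬ (x ≈ 0#) → Carrier
    inv-law : (x : Carrier) (p : ¬ (x ≈ 0#)) → x * inv x p ≈ 1#
    toFin    : Carrier → Fin (2 ^ n)
    fromFin  : Fin (2 ^ n) → Carrier
    toFin-cong : ∀ {x y} → x ≈ y → toFin x ≡ toFin y
    from∘to  : ∀ x → fromFin (toFin x) ≈ x
    to∘from  : ∀ i → toFin (fromFin i) ≡ i

allSubsets : (k : ℕ) → List (Vec Bool k)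
allSubsets zero    = [ [] ]
allSubsets (suc k) = concatMap (λ b → map (b ∷_) (allSubsets k)) (false ∷ true ∷ [])

allVecs : (k b : ℕ) → List (Vec ℕ k)
allVecs zero    b = [ [] ]
allVecs (suc k) b = concatMap (λ x → map (x ∷_) (allVecs k b)) (upTo (suc b))

isEmptySubset : ∀ {k} → Vec Bool k → Bool
isEmptySubset []       = true
isEmptySubset (b ∷ bs) = not b ∧ isEmptySubset bs

isPow2 : ℕ → Bool
isPow2 m = any (λ j → (2 ^ j) ≡ᵇ m) (upTo (suc m))

-- 0 or a power of 2 (padded parts of a 2-adic partition)
zeroOrPow2 : ℕ → Bool
zeroOrPow2 m = (m ≡ᵇ 0) Data.Bool.∨ isPow2 m

sumℕ : ∀ {k} → Vec ℕ k → ℕ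
sumℕ []       = 0
sumℕ (x ∷ xs) = x Data.Nat.+ sumℕ xs

decreasing : ∀ {k} → Vec ℕ k → Bool
decreasing []           = true
decreasing (x ∷ [])     = true
decreasing (x ∷ y ∷ xs) = (y ≤ᵇ x) ∧ decreasing (y ∷ xs)

-- A partition with at most k parts is represented as a weakly
-- decreasing vector in ℕ^k (its parts, padded with zeros).
-- Λ_k : 2-adic partitions of 2^(k-1) with at most k parts.
Λ : (k : ℕ) → List (Vec ℕ k)
Λ k = filterᵇ (λ v → decreasing v ∧ all zeroOrPow2 (toList v) ∧ (sumℕ v ≡ᵇ 2 ^ (k ∸ 1)))
              (allVecs k (2 ^ (k ∸ 1)))

count : ℕ → List ℕ → ℕ
count x xs = length (filterᵇ (λ y → x ≡ᵇ y) xs)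

isRearrangement : ∀ {k} → Vec ℕ k → Vec ℕ k → Bool
isRearrangement α l =
  all (λ x → count x (toList α) ≡ᵇ count x (toList l)) (toList α ++ toList l)

module _ {n : ℕ} (F : FiniteField n) where
  open FiniteField F using (Carrier; _≈_; _+_; _*_; -_; 0#; 1#; _≟_; inv)

  sumL : List Carrier → Carrier
  sumL = foldr _+_ 0#

  pow : Carrier → ℕ → Carrier
  pow x zero    = 1#
  pow x (suc m) = x * pow x m

  finv : Carrier → Carrier
  finv x with x ≟ 0#
  ... | yes _ = 0#
  ... | no p  = inv x p

  subsetSum : ∀ {k} → (Fin k → Carrier) → Vec Bool k → Carrier
  subsetSum v []       = 0#
  subsetSum v (b ∷ bs) =
    (if b then v zero else 0#) + subsetSum (λ i → v (suc i)) bs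

  F2-LinIndep : ∀ {k} → (Fin k → Carrier) → Set
  F2-LinIndep {k} v = ∀ (S : Vec Bool k) → subsetSum v S ≈ 0# → isEmptySubset S ≡ true

  -- Sum of f over the k-dimensional affine subspace a + span_{F_2}(v_1,…,v_k)
  -- (v linearly independent), i.e. over its 2^k distinct points.
  affineSum : ∀ {k} → (Carrier → Carrier) → Carrier → (Fin k → Carrier) → Carrier
  affineSum {k} f a v = sumL (map (λ S → f (a + subsetSum v S)) (allSubsets k))

  SumFree : ℕ → (Carrier → Carrier) → Set
  SumFree k f = ∀ (a : Carrier) (v : Fin k → Carrier) →
                F2-LinIndep v → ¬ (affineSum f a v ≈ 0#)

  det : ∀ {k} → (Fin k → Fin k → Carrier) → Carrier
  det {zero}  M = 1#
  det {suc k} M = go 1# (λ j → M zero j) (λ j i' j' → M (suc i') (punchIn j j'))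
    where
    go : ∀ {m} → Carrier → (Fin m → Carrier) → (Fin m → Fin k → Fin k → Carrier) → Carrier
    go {zero}  s r mn = 0#
    go {suc m} s r mn = s * r zero * det (mn zero) + go (- s) (λ j → r (suc j)) (λ j → mn (suc j))

  moore : ∀ {k} → (Fin k → Carrier) → Carrier
  moore u = det (λ i j → pow (u j) (2 ^ Data.Fin.toℕ i))

  monomial : ∀ {k} → Vec ℕ k → (Fin k → Carrier) → Carrier
  monomial []       u = 1#
  monomial (a ∷ as) u = pow (u zero) a * monomial as (λ i → u (suc i))

  -- monomial symmetric polynomial m_λ evaluated at u: sum over all
  -- distinct exponent vectors that are rearrangements of λ (padded)
  mono-sym : ∀ {k} → Vec ℕ k → (Fin k → Carrier) → Carrier
  mono-sym {k} l u =
    sumL (map (λ α → monomial α u)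
              (filterᵇ (λ α → isRearrangement α l) (allVecs k (sumℕ l))))

  Θ : (k : ℕ) → (Fin k → Carrier) → Carrier
  Θ k u = sumL (map (λ l → mono-sym l u) (Λ k))

{-# OPTIONS --safe #-}
module Submission where

-- Write L_a(x) = x(x + a), the 𝔽₂-linear map with kernel {0, a}.  Since 1/x + 1/(x+a) = a/L_a(x),
-- replacing v₀, …, v_m by L_{v₀}(v₁), …, L_{v₀}(v_m) halves the subspace, and the sum of 1/x over
-- a + span v is a nonzero multiple of 1/P(a) if P(a) ≠ 0, where P is the polynomial with root set
-- span v.  So only linear subspaces matter, where the sum of 1/x over nonzero x is Σ_j y_j² v_j for
-- the y with Σ_j y_j v_j^(2^s) = δ_{s,0} (0 ≤ s ≤ m).  Dually, for k = m+1, Θ_k(u) is the coefficient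
-- of X^(2^m) in the polynomial with root set span u, hence equals Σ_j z_j u_j^(2^k) for the z with
-- Σ_j z_j u_j^(2^s) = δ_{s,m}.  Applying powers of Frobenius to the first relations gives the second
-- ones with u = y and z_j = v_j^(2^m), and conversely, which matches the zeros of Θ_k with the bases
-- v of the subspaces on which the reciprocals sum to 0.
--
-- That Θ_k(u) is this coefficient follows from the generating function T(x) = 1 + Σ_i (xz)^(2^i),
-- which satisfies T² = T + xz: squaring one factor of Π_j T(u_j) does not change the coefficient of
-- z^(2^k), because z^(2^k - 1) does not occur in a product of k - 1 such factors.

open import Defs
open import Algebra.Bundles using (RawRing)
open import Data.Bool as Bool using (Bool; true; false; _∧_; T; if_then_else_)
open import Data.Bool.ListAction using (all)
open import Data.Bool.Properties using (T-∧; T-≡; ∧-assoc)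
open import Data.Fin as Fin using (Fin; toℕ; punchIn)
open import Data.Fin.Permutation using (Permutation′; permutation; _⟨$⟩ʳ_)
open import Data.Fin.Properties using (toℕ-inject₁; toℕ<n; any?)
open import Data.List using (List; []; _∷_; map; _++_; concatMap; upTo; applyUpTo; filterᵇ)
open import Data.List.Membership.Propositional using (lose)
open import Data.List.Membership.Propositional.Properties using (∈-upTo⁺)
open import Data.List.Relation.Unary.Any using (satisfied)
open import Data.List.Relation.Unary.Any.Properties using (any⁺; any⁻)
open import Data.Maybe using (Maybe; just; nothing)
open import Data.Nat as ℕ using (ℕ; zero; suc; _≡ᵇ_; _≤_; s≤s)
import Data.Nat.Properties as ℕₚ
open import Data.Product using (Σ; ∃; _×_; _,_; proj₁; proj₂)
open import Data.Sum using (_⊎_; inj₁; inj₂; [_,_]′)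
open import Data.Unit using (⊤; tt)
open import Data.Vec as Vec using (Vec; []; _∷_; toList)
import Data.Vec.Functional as Fun
open import Function using (_∘_; id; Equivalence)
open import Function.Bundles using (_⇔_; mk⇔)
open import Relation.Binary.PropositionalEquality as ≡ using (_≡_)
open import Relation.Nullary using (¬_; Dec; yes; no; contradiction; ¬?; _×-dec_; does)

-- A sum of reciprocals and a sum over partitions have no visible relation. Each is rewritten as a
-- pairing `Σ_j y_j v_j^(2^s)` of a basis with a dual system, and in that form the two differ only
-- by a power of Frobenius.
--
-- Determinants serve only to test independence. Independence, solvability of the dual systems and
-- the reciprocal sums all run by one induction on the dimension, in which `L` of the first vector
-- takes the place of a pivot step.
--
-- In the proof the series `T` is cut off at `i < k`. Then `T² = T + xz + (xz)^(2^k)`, and the extra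
-- end term is what yields the monic term `X^(2^k)`. The size `2^(k-1)` of the partitions arises as
-- `2^k - 2^(k-1)`: the degree of the polynomial minus the exponent whose coefficient is taken.
--
-- Failure of sum-freeness is a bare negation and supplies no subspace, so the existence of the
-- `u_j` has to be decided by searching the finite field.

-- Exponent vectors: sorting into partitions, and binary digit sums.

module TwoAdicPartitions where
  open import Data.Bool.Properties using (⇔→≡; T?)
  open import Data.Empty using (⊥-elim)
  open import Data.List.Membership.Propositional using (_∈_)
  open import Data.List.Membership.Propositional.Properties using (∈-∃++; ∈-++⁺ˡ; ∈-++⁺ʳ)
  open import Data.List.Relation.Binary.Permutation.Propositional as Perm using (_↭_; ↭-sym; ↭-trans; ↭⇒↭ₛ)
  open import Data.List.Relation.Binary.Permutation.Propositional.Properties using (filter-↭; ↭-length; shift; All-resp-↭)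
  open import Data.List.Relation.Binary.Pointwise using (Pointwise-≡⇒≡)
  open import Data.List.Relation.Unary.All as All using (All)
  open import Data.List.Relation.Unary.All.Properties using (all⁺; all⁻)
  open import Data.List.Relation.Unary.Any using (here; there)
  open import Data.List.Relation.Unary.Linked using ([]; [-]; _∷_)
  open import Data.List.Relation.Unary.Sorted.TotalOrder.Properties using (↗↭↗⇒≋)
  open import Data.Nat
  open import Data.Nat.ListAction using (sum)
  open import Data.Nat.ListAction.Properties using (sum-↭)
  open import Data.Nat.Properties
  open import Data.Vec using (fromList)
  open import Data.Vec.Properties using (cast-is-id; toList-cast; toList∘fromList; toList-injective; length-toList)
  open import Relation.Binary.Bundles using (DecTotalOrder)
  import Relation.Binary.Construct.Flip.EqAndOrd as Flip
  open import Relation.Binary.PropositionalEquality using (refl; sym; trans; cong; cong₂; subst)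

  open Equivalence using (to; from)

  T-⇔⇒≡ : ∀ {x y} → (T x → T y) → (T y → T x) → x ≡ y
  T-⇔⇒≡ f g = ⇔→≡ (mk⇔ (to T-≡ ∘ f ∘ from T-≡) (to T-≡ ∘ g ∘ from T-≡))

  -- Permutations and multiplicities

  count-↭ : ∀ z {xs ys} → xs ↭ ys → count z xs ≡ count z ys
  count-↭ z p = ↭-length (filter-↭ (T? ∘ (z ≡ᵇ_)) p)

  count-self : ∀ x xs → count x (x ∷ xs) ≡ suc (count x xs)
  count-self x xs rewrite to T-≡ (≡⇒≡ᵇ x x refl) = refl

  count-cancel : ∀ z x xs ys → count z (x ∷ xs) ≡ count z (x ∷ ys) → count z xs ≡ count z ys
  count-cancel z x xs ys eq with z ≡ᵇ x
  ... | true  = suc-injective eq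
  ... | false = eq

  count>0⇒∈ : ∀ z xs → 0 < count z xs → z ∈ xs
  count>0⇒∈ z (x ∷ xs) 0<c with z ≡ᵇ x in eq
  ... | true  = here (≡ᵇ⇒≡ z x (from T-≡ eq))
  ... | false = there (count>0⇒∈ z xs 0<c)

  count⇒↭ : ∀ xs ys → (∀ z → count z xs ≡ count z ys) → xs ↭ ys
  count⇒↭ [] [] _ = Perm.refl
  count⇒↭ [] (y ∷ ys) eq with () ← trans (eq y) (count-self y ys)
  count⇒↭ (x ∷ xs) ys eq
    with as , bs , refl ← ∈-∃++ (count>0⇒∈ x ys (subst (0 <_) (trans (sym (count-self x xs)) (eq x)) z<s))
    = ↭-trans (Perm.prep x (count⇒↭ xs (as ++ bs) rest)) (↭-sym (shift x as bs))
    where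
    rest : ∀ z → count z xs ≡ count z (as ++ bs)
    rest z = count-cancel z x xs (as ++ bs) (trans (eq z) (count-↭ z (shift x as bs)))

  isRearrangement⇔↭ : ∀ {k} (α l : Vec ℕ k) → T (isRearrangement α l) ⇔ (toList α ↭ toList l)
  isRearrangement⇔↭ α l = mk⇔ (λ r → count⇒↭ xs ys (counts r))
    (λ p → all⁻ same (All.universal (λ z → ≡⇒≡ᵇ _ _ (count-↭ z p)) (xs ++ ys)))
    where
    xs = toList α
    ys = toList l

    same : ℕ → Bool
    same z = count z xs ≡ᵇ count z ys

    -- Only values occurring in `xs` or `ys` are tested; any other value has multiplicity zero in
    -- both.
    counts : T (isRearrangement α l) → ∀ z → count z xs ≡ count z ys
    counts r z with count z xs in eqx | count z ys in eqy
    ... | zero  | zero  = refl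
    ... | suc _ | _ = trans (sym eqx) (trans (≡ᵇ⇒≡ _ _ (All.lookup (all⁺ same _ r)
          (∈-++⁺ˡ (count>0⇒∈ z xs (subst (0 <_) (sym eqx) z<s))))) eqy)
    ... | zero | suc _ = trans (sym eqx) (trans (≡ᵇ⇒≡ _ _ (All.lookup (all⁺ same _ r)
          (∈-++⁺ʳ xs (count>0⇒∈ z ys (subst (0 <_) (sym eqy) z<s))))) eqy)

  -- Decreasing rearrangements

  ≥-decTotalOrder : DecTotalOrder _ _ _
  ≥-decTotalOrder = Flip.decTotalOrder ≤-decTotalOrder

  open DecTotalOrder ≥-decTotalOrder using () renaming (totalOrder to ≥-totalOrder)
  open import Data.List.Relation.Unary.Sorted.TotalOrder ≥-totalOrder using (Sorted)
  open import Data.List.Sort ≥-decTotalOrder using (sort; sort-↭; sort-↗)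

  decreasing⇒Sorted : ∀ {k} (v : Vec ℕ k) → T (decreasing v) → Sorted (toList v)
  decreasing⇒Sorted []           _ = []
  decreasing⇒Sorted (x ∷ [])     _ = [-]
  decreasing⇒Sorted (x ∷ y ∷ xs) d =
    ≤ᵇ⇒≤ y x (proj₁ (to T-∧ d)) ∷ decreasing⇒Sorted (y ∷ xs) (proj₂ (to (T-∧ {y ≤ᵇ x}) d))

  Sorted⇒decreasing : ∀ {k} (v : Vec ℕ k) → Sorted (toList v) → T (decreasing v)
  Sorted⇒decreasing []           _       = _
  Sorted⇒decreasing (x ∷ [])     _       = _
  Sorted⇒decreasing (x ∷ y ∷ xs) (p ∷ s) = from T-∧ (≤⇒≤ᵇ p , Sorted⇒decreasing (y ∷ xs) s)

  sortᵛ : ∀ {k} → Vec ℕ k → Vec ℕ k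
  sortᵛ α = Vec.cast (trans (↭-length (sort-↭ (toList α))) (length-toList α)) (fromList (sort (toList α)))

  toList-sortᵛ : ∀ {k} (α : Vec ℕ k) → toList (sortᵛ α) ≡ sort (toList α)
  toList-sortᵛ α = trans (toList-cast _ (fromList (sort (toList α)))) (toList∘fromList (sort (toList α)))

  sortᵛ-↭ : ∀ {k} (α : Vec ℕ k) → toList α ↭ toList (sortᵛ α)
  sortᵛ-↭ α = subst (toList α ↭_) (sym (toList-sortᵛ α)) (↭-sym (sort-↭ (toList α)))

  sortᵛ-decreasing : ∀ {k} (α : Vec ℕ k) → T (decreasing (sortᵛ α))
  sortᵛ-decreasing α = Sorted⇒decreasing (sortᵛ α) (subst Sorted (sym (toList-sortᵛ α)) (sort-↗ (toList α)))

  sortᵛ-unique : ∀ {k} (α l : Vec ℕ k) → T (decreasing l) → toList α ↭ toList l → l ≡ sortᵛ α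
  sortᵛ-unique α l d p = trans (sym (cast-is-id refl l)) (toList-injective refl l (sortᵛ α) (Pointwise-≡⇒≡
    (↗↭↗⇒≋ ≥-totalOrder (decreasing⇒Sorted l d) (decreasing⇒Sorted (sortᵛ α) (sortᵛ-decreasing α))
      (↭⇒↭ₛ (↭-trans (↭-sym p) (sortᵛ-↭ α))))))

  _==_ : ∀ {k} → Vec ℕ k → Vec ℕ k → Bool
  []       == []       = true
  (x ∷ xs) == (y ∷ ys) = (x ≡ᵇ y) ∧ (xs == ys)

  ==⇒≡ : ∀ {k} (xs ys : Vec ℕ k) → T (xs == ys) → xs ≡ ys
  ==⇒≡ []       []       _ = refl
  ==⇒≡ (x ∷ xs) (y ∷ ys) t =
    cong₂ _∷_ (≡ᵇ⇒≡ x y (proj₁ (to T-∧ t))) (==⇒≡ xs ys (proj₂ (to (T-∧ {x ≡ᵇ y}) t)))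

  ==-refl : ∀ {k} (xs : Vec ℕ k) → T (xs == xs)
  ==-refl []       = _
  ==-refl (x ∷ xs) = from T-∧ (≡⇒≡ᵇ x x refl , ==-refl xs)

  isTwoAdic : ℕ → ∀ {k} → Vec ℕ k → Bool
  isTwoAdic N v = all zeroOrPow2 (toList v) ∧ (sumℕ v ≡ᵇ N)

  sumℕ-toList : ∀ {k} (v : Vec ℕ k) → sumℕ v ≡ sum (toList v)
  sumℕ-toList []       = refl
  sumℕ-toList (x ∷ xs) = cong (x +_) (sumℕ-toList xs)

  sumℕ-↭ : ∀ {k} (α l : Vec ℕ k) → toList α ↭ toList l → sumℕ α ≡ sumℕ l
  sumℕ-↭ α l p = trans (sumℕ-toList α) (trans (sum-↭ p) (sym (sumℕ-toList l)))

  isTwoAdic-↭ : ∀ N {k} (α l : Vec ℕ k) → toList α ↭ toList l → T (isTwoAdic N α) → T (isTwoAdic N l)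
  isTwoAdic-↭ N α l p t with z , s ← to (T-∧ {all zeroOrPow2 (toList α)}) t = from T-∧
    ( all⁻ zeroOrPow2 (All-resp-↭ p (all⁺ zeroOrPow2 _ z))
    , subst (λ x → T (x ≡ᵇ N)) (sumℕ-↭ α l p) s)

  -- For fixed `l` the left side selects the rearrangements of a partition; for fixed `α` the right
  -- side leaves a single `l`. This collapses the double sum in `Θ`.
  isPartition-of-sortᵛ : ∀ N {k} (α l : Vec ℕ k) →
    (decreasing l ∧ isTwoAdic N l) ∧ isRearrangement α l ≡ isTwoAdic N α ∧ (l == sortᵛ α)
  isPartition-of-sortᵛ N α l = T-⇔⇒≡ ⇒ ⇐
    where
    ⇒ : T ((decreasing l ∧ isTwoAdic N l) ∧ isRearrangement α l) → T (isTwoAdic N α ∧ (l == sortᵛ α))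
    ⇒ t with dz , r ← to (T-∧ {decreasing l ∧ isTwoAdic N l}) t
        with d , z ← to (T-∧ {decreasing l}) dz
        with p ← to (isRearrangement⇔↭ α l) r
        = from T-∧ (isTwoAdic-↭ N l α (↭-sym p) z , subst (λ σ → T (l == σ)) (sortᵛ-unique α l d p) (==-refl l))

    ⇐ : T (isTwoAdic N α ∧ (l == sortᵛ α)) → T ((decreasing l ∧ isTwoAdic N l) ∧ isRearrangement α l)
    ⇐ t with z , e ← to (T-∧ {isTwoAdic N α}) t
        with refl ← ==⇒≡ l (sortᵛ α) e
        = from T-∧ (from T-∧ (sortᵛ-decreasing α , isTwoAdic-↭ N α l (sortᵛ-↭ α) z)
                   , from (isRearrangement⇔↭ α l) (sortᵛ-↭ α))

  -- SumOfPowers l N: the binary digit sum of N is at most l.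
  data SumOfPowers : ℕ → ℕ → Set where
    none : ∀ {l} → SumOfPowers l 0
    even : ∀ {l m N} → SumOfPowers l m → N ≡ 2 * m → SumOfPowers l N
    odd  : ∀ {l m N} → SumOfPowers l m → N ≡ suc (2 * m) → SumOfPowers (suc l) N

  weaken : ∀ {l N} → SumOfPowers l N → SumOfPowers (suc l) N
  weaken none       = none
  weaken (even s e) = even (weaken s) e
  weaken (odd s e)  = odd (weaken s) e

  suc-SumOfPowers : ∀ {l N} → SumOfPowers l N → SumOfPowers (suc l) (suc N)
  suc-SumOfPowers none = odd none refl
  suc-SumOfPowers (even s refl) = odd s refl
  -- The carry clears the lowest digit, which saves one power; `weaken` gives it back.
  suc-SumOfPowers (odd {m = m} s refl) = even (weaken (suc-SumOfPowers s)) (sym (*-suc 2 m))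

  -- Removing the lowest binary digit of both summands lowers `i`; carries arise only at `i = 0`,
  -- where `suc-SumOfPowers` handles them.
  2^i+-SumOfPowers : ∀ i {l N} → SumOfPowers l N → SumOfPowers (suc l) (2 ^ i + N)
  2^i+-SumOfPowers zero    s = suc-SumOfPowers s
  2^i+-SumOfPowers (suc i) none = even (2^i+-SumOfPowers i none) (sym (*-distribˡ-+ 2 (2 ^ i) 0))
  2^i+-SumOfPowers (suc i) (even {m = m} s refl) = even (2^i+-SumOfPowers i s) (sym (*-distribˡ-+ 2 (2 ^ i) m))
  2^i+-SumOfPowers (suc i) (odd {m = m} s refl) = odd (2^i+-SumOfPowers i s)
    (trans (+-suc (2 ^ suc i) (2 * m)) (cong suc (sym (*-distribˡ-+ 2 (2 ^ i) m))))

  -- All `k` binary digits of `2^k - 1` are `1`: parity leaves only `odd`, and halving leads to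
  -- `2^(k-1) - 1`.
  2^k-1-needs-k-powers : ∀ k {l N} → SumOfPowers l N → suc N ≡ 2 ^ k → k ≤ l
  2^k-1-needs-k-powers zero _ _ = z≤n
  2^k-1-needs-k-powers (suc k) none eq = ⊥-elim (even≢odd (2 ^ k) 0 (sym eq))
  2^k-1-needs-k-powers (suc k) (even {m = m} s refl) eq = ⊥-elim (even≢odd (2 ^ k) m (sym eq))
  2^k-1-needs-k-powers (suc k) (odd {m = m} s refl) eq =
    s≤s (2^k-1-needs-k-powers k s (*-cancelˡ-≡ (suc m) (2 ^ k) 2 (trans (*-suc 2 m) eq)))

open TwoAdicPartitions

-- Characteristic 2: finite sums, the ring solver and Frobenius.

module CharTwo {n} (F : FiniteField n) where
  open FiniteField F hiding (zero) public
  import Algebra.Properties.Semiring.Sum semiring as Sum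
  open import Algebra.Properties.Semiring.Mult semiring using (×1-homo-*) renaming (_×_ to _·_)
  open import Algebra.Properties.Group +-group using () renaming (∙-cancelˡ to +-cancelˡ)
  open import Relation.Binary.Reasoning.Setoid setoid public

  *-cancelˡ-≉0 : ∀ {x y z} → ¬ (x ≈ 0#) → x * y ≈ x * z → y ≈ z
  *-cancelˡ-≉0 {x} {y} {z} x≉0 eq = begin
    y                    ≈⟨ undo y ⟨
    inv x x≉0 * (x * y)  ≈⟨ *-congˡ eq ⟩
    inv x x≉0 * (x * z)  ≈⟨ undo z ⟩
    z                    ∎
    where
    undo : ∀ w → inv x x≉0 * (x * w) ≈ w
    undo w = begin
      inv x x≉0 * (x * w)  ≈⟨ *-assoc _ _ _ ⟨
      inv x x≉0 * x * w    ≈⟨ *-congʳ (trans (*-comm _ _) (inv-law x x≉0)) ⟩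
      1# * w               ≈⟨ *-identityˡ w ⟩
      w                    ∎

  x*y≈0⇒y≈0 : ∀ {x y} → ¬ (x ≈ 0#) → x * y ≈ 0# → y ≈ 0#
  x*y≈0⇒y≈0 x≉0 eq = *-cancelˡ-≉0 x≉0 (trans eq (sym (zeroʳ _)))

  x*y≈0⇒x≈0∨y≈0 : ∀ {x y} → x * y ≈ 0# → x ≈ 0# ⊎ y ≈ 0#
  x*y≈0⇒x≈0∨y≈0 {x} eq with x ≟ 0#
  ... | yes x≈0 = inj₁ x≈0
  ... | no  x≉0 = inj₂ (x*y≈0⇒y≈0 x≉0 eq)

  -- Opaque, so that the summand can be inferred from a sum.
  opaque
    ∑ : ∀ {m} → (Fin m → Carrier) → Carrier
    ∑ = Sum.sum

    ∑-zero : (f : Fin 0 → Carrier) → ∑ f ≈ 0#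
    ∑-zero f = refl

    ∑-suc : ∀ {m} (f : Fin (suc m) → Carrier) → ∑ f ≈ f Fin.zero + ∑ (f ∘ Fin.suc)
    ∑-suc f = refl

    ∑-cong : ∀ {m} {f g : Fin m → Carrier} → (∀ i → f i ≈ g i) → ∑ f ≈ ∑ g
    ∑-cong f≈g = Sum.sum-cong-≋ f≈g

    ∑-+ : ∀ {m} (f g : Fin m → Carrier) → ∑ (λ i → f i + g i) ≈ ∑ f + ∑ g
    ∑-+ = Sum.∑-distrib-+

    ∑-comm : ∀ {m l} (f : Fin m → Fin l → Carrier) → ∑ (λ i → ∑ (f i)) ≈ ∑ (λ j → ∑ (λ i → f i j))
    ∑-comm = Sum.∑-comm

    *-∑ : ∀ {m} x (f : Fin m → Carrier) → x * ∑ f ≈ ∑ (λ i → x * f i)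
    *-∑ = Sum.*-distribˡ-sum

    ∑-permute : ∀ {m} (f : Fin m → Carrier) (π : Permutation′ m) → ∑ f ≈ ∑ (λ i → f (π ⟨$⟩ʳ i))
    ∑-permute = Sum.sum-permute

    ∑-const : ∀ m x → ∑ {m} (λ _ → x) ≈ m · x
    ∑-const m x = Sum.sum-replicate m

  -- Translation by 1 permutes the field, so summing all its elements gives 2^n · 1 ≈ 0.
  translation : Permutation′ (2 ℕ.^ n)
  translation = permutation (λ i → toFin (fromFin i + 1#)) (λ i → toFin (fromFin i + - 1#))
    (λ i → ≡.trans (toFin-cong (trans (+-congʳ (from∘to _)) (cancel (-‿inverseˡ 1#)))) (to∘from i))
    (λ i → ≡.trans (toFin-cong (trans (+-congʳ (from∘to _)) (cancel (-‿inverseʳ 1#)))) (to∘from i))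
    where
    cancel : ∀ {x y z} → y + z ≈ 0# → x + y + z ≈ x
    cancel eq = trans (+-assoc _ _ _) (trans (+-congˡ eq) (+-identityʳ _))

  2^n·1≈0 : (2 ℕ.^ n) · 1# ≈ 0#
  2^n·1≈0 = +-cancelˡ (∑ fromFin) _ _ (begin
    ∑ fromFin + (2 ℕ.^ n) · 1#                     ≈⟨ +-congˡ (∑-const (2 ℕ.^ n) 1#) ⟨
    ∑ fromFin + ∑ {2 ℕ.^ n} (λ _ → 1#)             ≈⟨ ∑-+ fromFin (λ _ → 1#) ⟨
    ∑ (λ i → fromFin i + 1#)                       ≈⟨ ∑-cong (λ i → from∘to _) ⟨
    ∑ (λ i → fromFin (toFin (fromFin i + 1#)))     ≈⟨ ∑-permute fromFin translation ⟨
    ∑ fromFin                                      ≈⟨ +-identityʳ _ ⟨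
    ∑ fromFin + 0#                                 ∎)

  -- `2^n` times `1#` is a product of `n` factors `2 · 1#`, and in a field one of them must vanish.
  1+1≈0 : 1# + 1# ≈ 0#
  1+1≈0 = trans (+-congˡ (sym (+-identityʳ 1#))) (go n 2^n·1≈0)
    where
    go : ∀ m → (2 ℕ.^ m) · 1# ≈ 0# → 2 · 1# ≈ 0#
    go zero    eq = contradiction (trans (sym eq) (+-identityʳ 1#)) 0≉1
    go (suc m) eq = [ id , go m ]′ (x*y≈0⇒x≈0∨y≈0 (trans (sym (×1-homo-* 2 (2 ℕ.^ m))) eq))

  x+x≈0 : ∀ x → x + x ≈ 0#
  x+x≈0 x = begin
    x + x            ≈⟨ +-cong (*-identityˡ x) (*-identityˡ x) ⟨
    1# * x + 1# * x  ≈⟨ distribʳ x 1# 1# ⟨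
    (1# + 1#) * x    ≈⟨ *-congʳ 1+1≈0 ⟩
    0# * x           ≈⟨ zeroˡ x ⟩
    0#               ∎

  x+y≈0⇒x≈y : ∀ {x y} → x + y ≈ 0# → x ≈ y
  x+y≈0⇒x≈y {x} {y} eq = begin
    x            ≈⟨ +-identityʳ x ⟨
    x + 0#       ≈⟨ +-congˡ (x+x≈0 y) ⟨
    x + (y + y)  ≈⟨ +-assoc x y y ⟨
    x + y + y    ≈⟨ +-congʳ eq ⟩
    0# + y       ≈⟨ +-identityˡ y ⟩
    y            ∎

  -x≈x : ∀ x → - x ≈ x
  -x≈x x = x+y≈0⇒x≈y (-‿inverseˡ x)

  -- Coefficients in `𝔽₂` build `x + x = 0` into the normal forms, so `solve` also proves identities
  -- special to characteristic 2, such as additivity of squaring.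
  module 𝔽₂-Solver where
    open import Algebra.Solver.Ring.AlmostCommutativeRing

    𝔽₂ : RawRing _ _
    𝔽₂ = record { _≈_ = _≡_ ; _+_ = Bool._xor_ ; _*_ = Bool._∧_ ; -_ = id ; 0# = false ; 1# = true }

    ⟦_⟧ : Bool → Carrier
    ⟦ false ⟧ = 0#
    ⟦ true  ⟧ = 1#

    𝔽₂⟶F : 𝔽₂ -Raw-AlmostCommutative⟶ fromCommutativeRing cring
    𝔽₂⟶F = record
      { ⟦_⟧    = ⟦_⟧
      ; +-homo = λ { false b → sym (+-identityˡ ⟦ b ⟧)
                   ; true false → sym (+-identityʳ 1#)
                   ; true true → sym 1+1≈0 }
      ; *-homo = λ { false b → sym (zeroˡ ⟦ b ⟧) ; true b → sym (*-identityˡ ⟦ b ⟧) }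
      ; -‿homo = λ b → sym (-x≈x ⟦ b ⟧)
      ; 0-homo = refl
      ; 1-homo = refl
      }

    coefficient≟ : ∀ a b → Maybe (⟦ a ⟧ ≈ ⟦ b ⟧)
    coefficient≟ false false = just refl
    coefficient≟ true  true  = just refl
    coefficient≟ _     _     = nothing

    open import Algebra.Solver.Ring 𝔽₂ (fromCommutativeRing cring) 𝔽₂⟶F coefficient≟
      using (solve; _:=_; _:+_; _:*_; con; Polynomial) public

    :0 : ∀ {m} → Polynomial m
    :0 = con false

    :1 : ∀ {m} → Polynomial m
    :1 = con true

  open 𝔽₂-Solver using (solve; _:=_; _:+_; _:*_; :0; :1) public

  ∑-≈0 : ∀ {m} {f : Fin m → Carrier} → (∀ i → f i ≈ 0#) → ∑ f ≈ 0#
  ∑-≈0 {zero}  {f} f≈0 = ∑-zero f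
  ∑-≈0 {suc m} {f} f≈0 = trans (∑-suc f) (trans (+-cong (f≈0 Fin.zero) (∑-≈0 (f≈0 ∘ Fin.suc))) (+-identityˡ 0#))

  ι : Bool → Carrier
  ι b = if b then 1# else 0#

  ∑-δ : ∀ {m} (f : ℕ → Carrier) a → a ℕ.< m → ∑ {m} (λ i → ι (toℕ i ℕ.≡ᵇ a) * f (toℕ i)) ≈ f a
  ∑-δ {suc m} f zero    _ = trans (∑-suc _) (trans (+-cong (*-identityˡ _) (∑-≈0 {m} (λ i → zeroˡ _))) (+-identityʳ _))
  ∑-δ {suc m} f (suc a) (ℕ.s≤s a<m) = trans (∑-suc _) (trans (+-cong (zeroˡ _) (∑-δ (f ∘ suc) a a<m)) (+-identityˡ _))

  -- In characteristic 2 the off-diagonal terms of a symmetric double sum cancel in pairs.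
  ∑-symmetric : ∀ {m} (f : Fin m → Fin m → Carrier) → (∀ i j → f i j ≈ f j i) →
                ∑ (λ i → ∑ (f i)) ≈ ∑ (λ i → f i i)
  ∑-symmetric {zero}  f f-sym = trans (∑-zero _) (sym (∑-zero _))
  ∑-symmetric {suc m} f f-sym = begin
    ∑ (λ i → ∑ (f i))
      ≈⟨ ∑-suc _ ⟩
    ∑ (f Fin.zero) + ∑ (λ i → ∑ (f (Fin.suc i)))
      ≈⟨ +-cong (∑-suc _) (trans (∑-cong (λ i → ∑-suc (f (Fin.suc i)))) (∑-+ _ _)) ⟩
    f₀₀ + row + (∑ (λ i → f (Fin.suc i) Fin.zero) + rest)
      ≈⟨ +-congˡ (+-congʳ (∑-cong (λ i → f-sym (Fin.suc i) Fin.zero))) ⟩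
    f₀₀ + row + (row + rest)
      ≈⟨ solve 3 (λ a b c → a :+ b :+ (b :+ c) := a :+ c) refl f₀₀ row rest ⟩
    f₀₀ + rest
      ≈⟨ +-congˡ (∑-symmetric (λ i j → f (Fin.suc i) (Fin.suc j)) (λ i j → f-sym (Fin.suc i) (Fin.suc j))) ⟩
    f₀₀ + ∑ (λ i → f (Fin.suc i) (Fin.suc i))
      ≈⟨ ∑-suc _ ⟨
    ∑ (λ i → f i i) ∎
    where
    f₀₀ row rest : Carrier
    f₀₀ = f Fin.zero Fin.zero
    row = ∑ (λ j → f Fin.zero (Fin.suc j))
    rest = ∑ (λ i → ∑ (λ j → f (Fin.suc i) (Fin.suc j)))

  -- Iterated Frobenius `x ↦ x^(2^i)`, by repeated squaring so that its laws follow from those of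
  -- one squaring; `pow-2^` links it to `pow`.
  φ : ℕ → Carrier → Carrier
  φ zero    x = x
  φ (suc i) x = φ i x * φ i x

  φ-cong : ∀ i {x y} → x ≈ y → φ i x ≈ φ i y
  φ-cong zero    eq = eq
  φ-cong (suc i) eq = *-cong (φ-cong i eq) (φ-cong i eq)

  φ-+ : ∀ i x y → φ i (x + y) ≈ φ i x + φ i y
  φ-+ zero    x y = refl
  φ-+ (suc i) x y = trans (*-cong (φ-+ i x y) (φ-+ i x y))
    (solve 2 (λ a b → (a :+ b) :* (a :+ b) := a :* a :+ b :* b) refl (φ i x) (φ i y))

  φ-* : ∀ i x y → φ i (x * y) ≈ φ i x * φ i y
  φ-* zero    x y = refl
  φ-* (suc i) x y = trans (*-cong (φ-* i x y) (φ-* i x y))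
    (solve 2 (λ a b → (a :* b) :* (a :* b) := (a :* a) :* (b :* b)) refl (φ i x) (φ i y))

  φ-0 : ∀ i → φ i 0# ≈ 0#
  φ-0 zero    = refl
  φ-0 (suc i) = trans (*-congʳ (φ-0 i)) (zeroˡ _)

  φ-1 : ∀ i → φ i 1# ≈ 1#
  φ-1 zero    = refl
  φ-1 (suc i) = trans (*-cong (φ-1 i) (φ-1 i)) (*-identityˡ 1#)

  φ-∑ : ∀ i {m} (f : Fin m → Carrier) → φ i (∑ f) ≈ ∑ (φ i ∘ f)
  φ-∑ i {zero}  f = trans (φ-cong i (∑-zero f)) (trans (φ-0 i) (sym (∑-zero _)))
  φ-∑ i {suc m} f = begin
    φ i (∑ f)                               ≈⟨ φ-cong i (∑-suc f) ⟩
    φ i (f Fin.zero + ∑ (f ∘ Fin.suc))      ≈⟨ φ-+ i _ _ ⟩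
    φ i (f Fin.zero) + φ i (∑ (f ∘ Fin.suc)) ≈⟨ +-congˡ (φ-∑ i (f ∘ Fin.suc)) ⟩
    φ i (f Fin.zero) + ∑ (φ i ∘ f ∘ Fin.suc) ≈⟨ ∑-suc (φ i ∘ f) ⟨
    ∑ (φ i ∘ f)                             ∎

  φ-∘ : ∀ i j x → φ i (φ j x) ≈ φ (i ℕ.+ j) x
  φ-∘ zero    j x = refl
  φ-∘ (suc i) j x = *-cong (φ-∘ i j x) (φ-∘ i j x)

  pow-+ : ∀ x a b → pow F x (a ℕ.+ b) ≈ pow F x a * pow F x b
  pow-+ x zero    b = sym (*-identityˡ _)
  pow-+ x (suc a) b = trans (*-congˡ (pow-+ x a b)) (sym (*-assoc _ _ _))

  pow-2^ : ∀ i x → pow F x (2 ℕ.^ i) ≈ φ i x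
  pow-2^ zero    x = *-identityʳ x
  pow-2^ (suc i) x = begin
    pow F x (2 ℕ.^ i ℕ.+ (2 ℕ.^ i ℕ.+ 0))        ≡⟨ ≡.cong (λ a → pow F x (2 ℕ.^ i ℕ.+ a)) (ℕₚ.+-identityʳ (2 ℕ.^ i)) ⟩
    pow F x (2 ℕ.^ i ℕ.+ 2 ℕ.^ i)                ≈⟨ pow-+ x (2 ℕ.^ i) (2 ℕ.^ i) ⟩
    pow F x (2 ℕ.^ i) * pow F x (2 ℕ.^ i)        ≈⟨ *-cong (pow-2^ i x) (pow-2^ i x) ⟩
    φ i x * φ i x                                ∎

-- Determinants in characteristic 2 and the recursion for the Moore determinant.

module Determinant {n} (F : FiniteField n) where
  open CharTwo F

  Matrix : ℕ → Set
  Matrix k = Fin k → Fin k → Carrier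

  minor : ∀ {k} → Matrix (suc k) → Fin (suc k) → Matrix k
  minor M j i' j' = M (Fin.suc i') (punchIn j j')

  altSum : ∀ {k} m → Carrier → (Fin m → Carrier) → (Fin m → Matrix k) → Carrier
  altSum zero    s r mn = 0#
  altSum (suc m) s r mn = s * r Fin.zero * det F (mn Fin.zero) + altSum m (- s) (r ∘ Fin.suc) (mn ∘ Fin.suc)

  -- `y` captures what remains of the expansion after the first two columns.
  det-tail : ∀ {k} (M : Matrix (2 ℕ.+ k)) → Σ Carrier λ y →
    det F M ≡ 1# * M Fin.zero Fin.zero * det F (minor M Fin.zero)
              + (- 1# * M Fin.zero (Fin.suc Fin.zero) * det F (minor M (Fin.suc Fin.zero)) + y)
  det-tail M = _ , ≡.refl

  -- The helper of det lives in a where block and has no name outside it.  The underscore is solved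
  -- to it once with-abstraction has turned all its arguments into variables; after two unfoldings
  -- its two size arguments are distinct (k and suc k), so they can be generalised separately.
  mutual
    go : ∀ {k m} → Matrix (suc k) → Carrier → (Fin m → Carrier) → (Fin m → Matrix k) → Carrier
    go M s r mn = _

    det-tail-go : ∀ {k} (M : Matrix (2 ℕ.+ k)) →
      proj₁ (det-tail M) ≡ go M (- - 1#) (λ j → M Fin.zero (Fin.suc (Fin.suc j))) (λ j → minor M (Fin.suc (Fin.suc j)))
    det-tail-go {k} M with - - 1# | (λ (j : Fin k) → M Fin.zero (Fin.suc (Fin.suc j))) | (λ (j : Fin k) → minor M (Fin.suc (Fin.suc j)))
    ... | s | r | mn with suc k | M | mn
    ... | k' | M' | mn' = ≡.refl

  go-altSum : ∀ {k m} (M : Matrix (suc k)) s (r : Fin m → Carrier) mn → go M s r mn ≡ altSum m s r mn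
  go-altSum {m = zero}  M s r mn = ≡.refl
  go-altSum {m = suc m} M s r mn =
    ≡.cong (s * r Fin.zero * det F (mn Fin.zero) +_) (go-altSum M (- s) (r ∘ Fin.suc) (mn ∘ Fin.suc))

  det-altSum : ∀ {k} (M : Matrix (suc k)) → det F M ≡ altSum (suc k) 1# (M Fin.zero) (minor M)
  det-altSum {zero}  M = ≡.refl
  det-altSum {suc k} M = ≡.trans (proj₂ (det-tail M)) (≡.cong
    (λ y → 1# * M Fin.zero Fin.zero * det F (minor M Fin.zero)
           + (- 1# * M Fin.zero (Fin.suc Fin.zero) * det F (minor M (Fin.suc Fin.zero)) + y))
    (≡.trans (det-tail-go M)
      (go-altSum M (- - 1#) (λ j → M Fin.zero (Fin.suc (Fin.suc j))) (λ j → minor M (Fin.suc (Fin.suc j))))))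

  -- The sign flips at each step, but `- s` equals `s` in characteristic 2, so `s ≈ 1#` is an
  -- invariant.
  altSum-∑ : ∀ {k} m {s} → s ≈ 1# → (r : Fin m → Carrier) (mn : Fin m → Matrix k) →
             altSum m s r mn ≈ ∑ (λ j → r j * det F (mn j))
  altSum-∑ zero    s≈1 r mn = sym (∑-zero _)
  altSum-∑ (suc m) s≈1 r mn = trans
    (+-cong (*-congʳ (trans (*-congʳ s≈1) (*-identityˡ _)))
            (altSum-∑ m (trans (-x≈x _) s≈1) (r ∘ Fin.suc) (mn ∘ Fin.suc)))
    (sym (∑-suc _))

  det-expand : ∀ {k} (M : Matrix (suc k)) → det F M ≈ ∑ (λ j → M Fin.zero j * det F (minor M j))
  det-expand M = trans (reflexive (det-altSum M)) (altSum-∑ _ refl _ _)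

  det-cong : ∀ {k} {M N : Matrix k} → (∀ i j → M i j ≈ N i j) → det F M ≈ det F N
  det-cong {zero}  eq = refl
  det-cong {suc k} {M} {N} eq = begin
    det F M                                  ≈⟨ det-expand M ⟩
    ∑ (λ j → M Fin.zero j * det F (minor M j)) ≈⟨ ∑-cong (λ j → *-cong (eq Fin.zero j) (det-cong (λ i' j' → eq (Fin.suc i') (punchIn j j')))) ⟩
    ∑ (λ j → N Fin.zero j * det F (minor N j)) ≈⟨ det-expand N ⟨
    det F N                                  ∎

  det-zero-column : ∀ {k} (M : Matrix (suc k)) → (∀ i → M i Fin.zero ≈ 0#) → det F M ≈ 0#
  det-zero-column {k} M eq = trans (det-expand M) (∑-≈0 (term k M eq))
    where
    term : ∀ k (M : Matrix (suc k)) → (∀ i → M i Fin.zero ≈ 0#) → ∀ j → M Fin.zero j * det F (minor M j) ≈ 0#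
    term k       M eq Fin.zero    = trans (*-congʳ (eq Fin.zero)) (zeroˡ _)
    term (suc k) M eq (Fin.suc j) = trans (*-congˡ (det-zero-column (minor M (Fin.suc j)) (eq ∘ Fin.suc))) (zeroʳ _)

  -- The ordered pairs of distinct columns come in pairs (a , b), (b , a) with equal terms.
  ∑-distinct-pairs : ∀ {m} (H : Fin (2 ℕ.+ m) → Fin (2 ℕ.+ m) → (Fin m → Fin (2 ℕ.+ m)) → Carrier) →
    (∀ a b f → H a b f ≈ H b a f) → (∀ a b {f g} → (∀ x → f x ≡ g x) → H a b f ≈ H a b g) →
    ∑ (λ j → ∑ (λ j' → H j (punchIn j j') (punchIn j ∘ punchIn j'))) ≈ 0#
  ∑-distinct-pairs {m} H H-sym H-ext = begin
    ∑ (λ j → ∑ (λ j' → H j (punchIn j j') (punchIn j ∘ punchIn j')))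
      ≈⟨ ∑-suc _ ⟩
    first + ∑ (λ j → ∑ (λ j' → H (Fin.suc j) (punchIn (Fin.suc j) j') (punchIn (Fin.suc j) ∘ punchIn j')))
      ≈⟨ +-congˡ (trans (∑-cong (λ j → ∑-suc _)) (∑-+ _ _)) ⟩
    first + (∑ (λ j → H (Fin.suc j) Fin.zero (Fin.suc ∘ punchIn j)) + rest)
      ≈⟨ +-congˡ (+-cong (∑-cong (λ j → H-sym _ _ _)) (rest≈0 m H H-sym H-ext)) ⟩
    first + (first + 0#)
      ≈⟨ solve 1 (λ a → a :+ (a :+ :0) := :0) refl first ⟩
    0# ∎
    where
    first rest : Carrier
    first = ∑ (λ j → H Fin.zero (Fin.suc j) (Fin.suc ∘ punchIn j))
    rest = ∑ (λ j → ∑ (λ j' → H (Fin.suc j) (Fin.suc (punchIn j j')) (punchIn (Fin.suc j) ∘ punchIn (Fin.suc j'))))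

    rest≈0 : ∀ m (H : Fin (2 ℕ.+ m) → Fin (2 ℕ.+ m) → (Fin m → Fin (2 ℕ.+ m)) → Carrier) →
      (∀ a b f → H a b f ≈ H b a f) → (∀ a b {f g} → (∀ x → f x ≡ g x) → H a b f ≈ H a b g) →
      ∑ (λ j → ∑ (λ j' → H (Fin.suc j) (Fin.suc (punchIn j j')) (punchIn (Fin.suc j) ∘ punchIn (Fin.suc j')))) ≈ 0#
    rest≈0 zero    H H-sym H-ext = ∑-≈0 (λ j → ∑-zero _)
    rest≈0 (suc m) H H-sym H-ext = trans
      -- Skipping two columns other than column `0` fixes column `0` and acts as
      -- `punchIn j ∘ punchIn j'` on the rest. It agrees with `lift 1` of that map only pointwise,
      -- which is what `H-ext` is for.
      (∑-cong (λ j → ∑-cong (λ j' → H-ext _ _ (λ { Fin.zero → ≡.refl ; (Fin.suc x) → ≡.refl }))))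
      (∑-distinct-pairs (λ a b f → H (Fin.suc a) (Fin.suc b) (Fin.lift 1 f))
        (λ a b f → H-sym _ _ _)
        (λ a b eq → H-ext _ _ (λ { Fin.zero → ≡.refl ; (Fin.suc x) → ≡.cong Fin.suc (eq x) })))

  det-equal-rows : ∀ {k} (M : Matrix (2 ℕ.+ k)) → (∀ j → M Fin.zero j ≈ M (Fin.suc Fin.zero) j) → det F M ≈ 0#
  det-equal-rows M eq = begin
    det F M
      ≈⟨ det-expand M ⟩
    ∑ (λ j → M Fin.zero j * det F (minor M j))
      ≈⟨ ∑-cong (λ j → *-cong (eq j) (det-expand (minor M j))) ⟩
    ∑ (λ j → r j * ∑ (λ j' → r (punchIn j j') * det F (minor (minor M j) j')))
      ≈⟨ ∑-cong (λ j → trans (*-∑ _ _) (∑-cong (λ j' → sym (*-assoc _ _ _)))) ⟩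
    ∑ (λ j → ∑ (λ j' → H j (punchIn j j') (punchIn j ∘ punchIn j')))
      ≈⟨ ∑-distinct-pairs H (λ a b f → *-congʳ (*-comm _ _))
           (λ a b eq′ → *-congˡ (det-cong (λ i' j' → reflexive (≡.cong (M (Fin.suc (Fin.suc i'))) (eq′ j'))))) ⟩
    0# ∎
    where
    r = M (Fin.suc Fin.zero)
    H = λ a b f → r a * r b * det F (λ i' j' → M (Fin.suc (Fin.suc i')) (f j'))

  infixr 5 _∷ʳ_
  _∷ʳ_ : ∀ {k m} → (Fin m → Carrier) → (Fin k → Fin m → Carrier) → Fin (suc k) → Fin m → Carrier
  (r ∷ʳ M) Fin.zero    = r
  (r ∷ʳ M) (Fin.suc i) = M i

  det-first-row-linear : ∀ {k} c (r r' : Fin (suc k) → Carrier) (M : Fin k → Fin (suc k) → Carrier) →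
    det F ((λ j → r j + c * r' j) ∷ʳ M) ≈ det F (r ∷ʳ M) + c * det F (r' ∷ʳ M)
  det-first-row-linear c r r' M = begin
    det F ((λ j → r j + c * r' j) ∷ʳ M)
      ≈⟨ det-expand ((λ j → r j + c * r' j) ∷ʳ M) ⟩
    ∑ (λ j → (r j + c * r' j) * D j)
      ≈⟨ ∑-cong (λ j → solve 4 (λ a b d e → (a :+ b :* d) :* e := a :* e :+ b :* (d :* e)) refl (r j) c (r' j) (D j)) ⟩
    ∑ (λ j → r j * D j + c * (r' j * D j))
      ≈⟨ ∑-+ _ _ ⟩
    ∑ (λ j → r j * D j) + ∑ (λ j → c * (r' j * D j))
      ≈⟨ +-cong (det-expand (r ∷ʳ M)) (trans (*-congˡ (det-expand (r' ∷ʳ M))) (*-∑ _ _)) ⟨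
    det F (r ∷ʳ M) + c * det F (r' ∷ʳ M) ∎
    where
    D : Fin _ → Carrier
    D j = det F (λ i' j' → M i' (punchIn j j'))

  addRows : ∀ {k m} → (ℕ → Carrier) → (Fin (suc k) → Fin m → Carrier) → Fin k → Fin m → Carrier
  addRows c M i j = M (Fin.suc i) j + c (toℕ i) * M (Fin.inject₁ i) j

  -- Linearity in row `1` splits off `c 0` times the determinant of `N`, whose first two rows
  -- coincide; the other part is the induction hypothesis on the minors.
  det-addRows : ∀ {k} c (M : Matrix (suc k)) → det F (M Fin.zero ∷ʳ addRows c M) ≈ det F M
  det-addRows {zero}  c M = det-cong {M = M Fin.zero ∷ʳ addRows c M} {N = M} (λ { Fin.zero j → refl })
  det-addRows {suc k} c M = begin
    det F (M₀ ∷ʳ addRows c M)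
      ≈⟨ det-expand (M₀ ∷ʳ addRows c M) ⟩
    ∑ (λ j → M₀ j * det F (minor (M₀ ∷ʳ addRows c M) j))
      ≈⟨ ∑-cong (λ j → *-congˡ (split j)) ⟩
    ∑ (λ j → M₀ j * (det F (minor M j) + c 0 * det F (minor N j)))
      ≈⟨ ∑-cong (λ j → solve 4 (λ a b d e → a :* (b :+ d :* e) := a :* b :+ d :* (a :* e)) refl
           (M₀ j) (det F (minor M j)) (c 0) (det F (minor N j))) ⟩
    ∑ (λ j → M₀ j * det F (minor M j) + c 0 * (M₀ j * det F (minor N j)))
      ≈⟨ ∑-+ _ _ ⟩
    ∑ (λ j → M₀ j * det F (minor M j)) + ∑ (λ j → c 0 * (M₀ j * det F (minor N j)))
      ≈⟨ +-cong (det-expand M) (trans (*-congˡ (det-expand N)) (*-∑ _ _)) ⟨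
    det F M + c 0 * det F N
      ≈⟨ +-congˡ (*-congˡ (det-equal-rows N (λ j → refl))) ⟩
    det F M + c 0 * 0#
      ≈⟨ solve 2 (λ a b → a :+ b :* :0 := a) refl _ _ ⟩
    det F M ∎
    where
    M₀ = M Fin.zero
    c⁺ = c ∘ suc
    N : Matrix (2 ℕ.+ k)
    N = M₀ ∷ʳ M₀ ∷ʳ addRows c⁺ (M ∘ Fin.suc)

    row₀ row₁ : Fin (2 ℕ.+ k) → Fin (suc k) → Carrier
    row₀ j j' = M₀ (punchIn j j')
    row₁ j j' = minor M j Fin.zero j' + c 0 * row₀ j j'

    split : ∀ j → det F (minor (M₀ ∷ʳ addRows c M) j) ≈ det F (minor M j) + c 0 * det F (minor N j)
    split j = begin
      det F (minor (M₀ ∷ʳ addRows c M) j)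
        ≈⟨ det-cong {M = minor (M₀ ∷ʳ addRows c M) j} {N = row₁ j ∷ʳ addRows c⁺ (minor M j)} (λ { Fin.zero j' → refl ; (Fin.suc i') j' → refl }) ⟩
      det F (row₁ j ∷ʳ addRows c⁺ (minor M j))
        ≈⟨ det-first-row-linear (c 0) (minor M j Fin.zero) (row₀ j) (addRows c⁺ (minor M j)) ⟩
      det F (minor M j Fin.zero ∷ʳ addRows c⁺ (minor M j)) + c 0 * det F (row₀ j ∷ʳ addRows c⁺ (minor M j))
        ≈⟨ +-cong (det-addRows c⁺ (minor M j)) (*-congˡ (det-cong {M = row₀ j ∷ʳ addRows c⁺ (minor M j)} {N = minor N j} (λ { Fin.zero j' → refl ; (Fin.suc i') j' → refl }))) ⟩
      det F (minor M j) + c 0 * det F (minor N j) ∎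

  -- v ↦ v(v + a) is 𝔽₂-linear with kernel {0 , a}.
  L : Carrier → Carrier → Carrier
  L a x = x * (x + a)

  quotient : ∀ {k} → (Fin (suc k) → Carrier) → Fin k → Carrier
  quotient v j = L (v Fin.zero) (v (Fin.suc j))

  φ-L : ∀ i a x → φ i (L a x) ≈ φ (suc i) x + φ i a * φ i x
  φ-L i a x = trans (φ-* i x (x + a)) (trans (*-congˡ (φ-+ i x a))
    (solve 2 (λ x a → x :* (x :+ a) := x :* x :+ a :* x) refl (φ i x) (φ i a)))

  -- Adding `v₀^(2^i)` times row `i` to row `i + 1` turns the entries of that row into
  -- `L v₀ (v j)^(2^i)`. Below the first row, column `0` vanishes because `L v₀ v₀` does, and the
  -- Moore matrix of `quotient v` remains.
  moore-suc : ∀ {k} (v : Fin (suc k) → Carrier) → moore F v ≈ v Fin.zero * moore F (quotient v)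
  moore-suc {k} v = begin
    moore F v
      ≈⟨ det-cong (λ i j → pow-2^ (toℕ i) (v j)) ⟩
    det F M
      ≈⟨ det-addRows (λ i → φ i v₀) M ⟨
    det F N
      ≈⟨ trans (det-expand N) (∑-suc _) ⟩
    v₀ * det F (minor N Fin.zero) + ∑ (λ j → N Fin.zero (Fin.suc j) * det F (minor N (Fin.suc j)))
      ≈⟨ +-cong (*-congˡ (det-cong entry)) (∑-≈0 (λ j → trans (*-congˡ (zero-column k N first j)) (zeroʳ _))) ⟩
    v₀ * moore F (quotient v) + 0#
      ≈⟨ +-identityʳ _ ⟩
    v₀ * moore F (quotient v) ∎
    where
    v₀ = v Fin.zero
    M : Matrix (suc k)
    M i j = φ (toℕ i) (v j)
    N : Matrix (suc k)
    N = M Fin.zero ∷ʳ addRows (λ i → φ i v₀) M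

    step : ∀ i j → addRows (λ i → φ i v₀) M i j ≈ φ (toℕ i) (L v₀ (v j))
    step i j = trans (+-congˡ (*-congˡ (reflexive (≡.cong (λ a → φ a (v j)) (toℕ-inject₁ i)))))
                     (sym (φ-L (toℕ i) v₀ (v j)))

    entry : ∀ i j → minor N Fin.zero i j ≈ pow F (quotient v j) (2 ℕ.^ toℕ i)
    entry i j = trans (step i (Fin.suc j)) (sym (pow-2^ (toℕ i) (quotient v j)))

    first : ∀ i → addRows (λ i → φ i v₀) M i Fin.zero ≈ 0#
    first i = trans (step i Fin.zero) (trans (φ-cong (toℕ i) (trans (*-congˡ (x+x≈0 v₀)) (zeroʳ v₀))) (φ-0 (toℕ i)))

    zero-column : ∀ k (N : Matrix (suc k)) → (∀ i → N (Fin.suc i) Fin.zero ≈ 0#) → ∀ j → det F (minor N (Fin.suc j)) ≈ 0#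
    zero-column (suc k) N eq j = det-zero-column (minor N (Fin.suc j)) eq

-- 𝔽₂-independence and the linear systems of the Moore matrix.

module Independence {n} (F : FiniteField n) where
  open CharTwo F
  open Determinant F using (L; φ-L; quotient; moore-suc)

  L-+ : ∀ a x y → L a (x + y) ≈ L a x + L a y
  L-+ = solve 3 (λ a x y → (x :+ y) :* (x :+ y :+ a) := x :* (x :+ a) :+ y :* (y :+ a)) refl

  L≈0 : ∀ {a x} → L a x ≈ 0# → x ≈ 0# ⊎ x ≈ a
  L≈0 eq = [ inj₁ , inj₂ ∘ x+y≈0⇒x≈y ]′ (x*y≈0⇒x≈0∨y≈0 eq)

  -- Independence by Gaussian elimination: passing to the quotient by v₀ is applying L v₀.
  Indep : ∀ {k} → (Fin k → Carrier) → Set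
  Indep {zero}  v = ⊤
  Indep {suc k} v = ¬ (v Fin.zero ≈ 0#) × Indep (quotient v)

  subsetSum-quotient : ∀ {k} (v : Fin (suc k) → Carrier) S →
                       subsetSum F (quotient v) S ≈ L (v Fin.zero) (subsetSum F (v ∘ Fin.suc) S)
  subsetSum-quotient v S = go (v ∘ Fin.suc) S
    where
    a = v Fin.zero
    summand : ∀ x b → (Bool.if b then L a x else 0#) ≈ L a (Bool.if b then x else 0#)
    summand x true  = refl
    summand x false = sym (zeroˡ _)
    go : ∀ {k} (u : Fin k → Carrier) S → subsetSum F (L a ∘ u) S ≈ L a (subsetSum F u S)
    go u []      = sym (zeroˡ _)
    go u (b ∷ S) = trans (+-cong (summand (u Fin.zero) b) (go (u ∘ Fin.suc) S)) (sym (L-+ a _ _))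

  subsetSum-empty : ∀ {k} (v : Fin k → Carrier) S → isEmptySubset S ≡ true → subsetSum F v S ≈ 0#
  subsetSum-empty v []          _ = refl
  subsetSum-empty v (false ∷ S) e = trans (+-identityˡ _) (subsetSum-empty (v ∘ Fin.suc) S e)

  empty-subset : ∀ k → isEmptySubset (Vec.replicate k false) ≡ true
  empty-subset zero    = ≡.refl
  empty-subset (suc k) = empty-subset k

  Indep⇒LinIndep : ∀ {k} (v : Fin k → Carrier) → Indep v → F2-LinIndep F v
  Indep⇒LinIndep v ind [] _ = ≡.refl
  Indep⇒LinIndep v (v₀≉0 , ind) (b ∷ S) eq = lead b eq
    where
    x = subsetSum F (v ∘ Fin.suc) S

    Lx≈0 : ∀ b → (Bool.if b then v Fin.zero else 0#) + x ≈ 0# → L (v Fin.zero) x ≈ 0#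
    Lx≈0 true  eq = trans (*-congˡ (trans (+-comm _ _) eq)) (zeroʳ _)
    Lx≈0 false eq = trans (*-congʳ (trans (sym (+-identityˡ x)) eq)) (zeroˡ _)

    S-empty : isEmptySubset S ≡ true
    S-empty = Indep⇒LinIndep (quotient v) ind S (trans (subsetSum-quotient v S) (Lx≈0 b eq))

    lead : ∀ b → (Bool.if b then v Fin.zero else 0#) + x ≈ 0# → isEmptySubset (b ∷ S) ≡ true
    lead false _ = S-empty
    lead true eq = contradiction
      (trans (sym (+-identityʳ _)) (trans (+-congˡ (sym (subsetSum-empty (v ∘ Fin.suc) S S-empty))) eq)) v₀≉0

  LinIndep⇒Indep : ∀ {k} (v : Fin k → Carrier) → F2-LinIndep F v → Indep v
  LinIndep⇒Indep {zero}  v lin = tt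
  LinIndep⇒Indep {suc k} v lin = v₀≉0 , LinIndep⇒Indep (quotient v) lin′
    where
    v₀≉0 : ¬ (v Fin.zero ≈ 0#)
    v₀≉0 v₀≈0 with () ← lin (true ∷ Vec.replicate k false)
      (trans (+-cong v₀≈0 (subsetSum-empty (v ∘ Fin.suc) (Vec.replicate k false) (empty-subset k))) (+-identityˡ 0#))

    lin′ : F2-LinIndep F (quotient v)
    -- A relation in the quotient places the sum in the kernel of `L v₀`, that is at `0` or `v₀`; it
    -- lifts to a relation of `v` without or with `v₀`.
    lin′ S eq with L≈0 (trans (sym (subsetSum-quotient v S)) eq)
    ... | inj₁ x≈0  = lin (false ∷ S) (trans (+-identityˡ _) x≈0)
    ... | inj₂ x≈v₀ with () ← lin (true ∷ S) (trans (+-congˡ x≈v₀) (x+x≈0 _))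

  -- By `moore-suc` the determinant is the product of the pivots met in the elimination.
  moore≉0⇒Indep : ∀ {k} (v : Fin k → Carrier) → ¬ (moore F v ≈ 0#) → Indep v
  moore≉0⇒Indep {zero}  v _ = tt
  moore≉0⇒Indep {suc k} v m≉0 =
    (λ v₀≈0 → m≉0 (trans (moore-suc v) (trans (*-congʳ v₀≈0) (zeroˡ _)))) ,
    moore≉0⇒Indep (quotient v) (λ m≈0 → m≉0 (trans (moore-suc v) (trans (*-congˡ m≈0) (zeroʳ _))))

  Indep⇒moore≉0 : ∀ {k} (v : Fin k → Carrier) → Indep v → ¬ (moore F v ≈ 0#)
  Indep⇒moore≉0 {zero}  v _ m≈0 = 0≉1 (sym m≈0)
  Indep⇒moore≉0 {suc k} v (v₀≉0 , ind) m≈0 =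
    Indep⇒moore≉0 (quotient v) ind (x*y≈0⇒y≈0 v₀≉0 (trans (sym (moore-suc v)) m≈0))

  -- Row `s` of the Moore matrix of `v` applied to the column `y`, with `s` allowed beyond the size
  -- of the matrix.
  pair : ∀ {k} → (Fin k → Carrier) → (Fin k → Carrier) → ℕ → Carrier
  pair y v s = ∑ (λ j → y j * φ s (v j))

  pair-suc : ∀ {k} (y v : Fin (suc k) → Carrier) s →
             pair y v s ≈ y Fin.zero * φ s (v Fin.zero) + pair (y ∘ Fin.suc) (v ∘ Fin.suc) s
  pair-suc y v s = ∑-suc _

  pair-tail : ∀ {k} (y v : Fin (suc k) → Carrier) → v Fin.zero ≈ 0# → ∀ s →
              pair (y ∘ Fin.suc) (v ∘ Fin.suc) s ≈ pair y v s
  pair-tail y v v₀≈0 s = sym (trans (pair-suc y v s) (trans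
    (+-congʳ (trans (*-congˡ (trans (φ-cong s v₀≈0) (φ-0 s))) (zeroʳ _))) (+-identityˡ _)))

  pair-L : ∀ {k} a (y v : Fin k → Carrier) s → pair y (L a ∘ v) s ≈ pair y v (suc s) + φ s a * pair y v s
  pair-L a y v s = begin
    pair y (L a ∘ v) s
      ≈⟨ ∑-cong (λ j → trans (*-congˡ (φ-L s a (v j))) (distribˡ _ _ _)) ⟩
    ∑ (λ j → y j * φ (suc s) (v j) + y j * (φ s a * φ s (v j)))
      ≈⟨ ∑-+ _ _ ⟩
    pair y v (suc s) + ∑ (λ j → y j * (φ s a * φ s (v j)))
      ≈⟨ +-congˡ (∑-cong (λ j → solve 3 (λ a b c → a :* (b :* c) := b :* (a :* c)) refl (y j) (φ s a) (φ s (v j)))) ⟩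
    pair y v (suc s) + ∑ (λ j → φ s a * (y j * φ s (v j)))
      ≈⟨ +-congˡ (*-∑ _ _) ⟨
    pair y v (suc s) + φ s a * pair y v s ∎

  -- The term y₀ v₀^(2^s) contributes to neither side, since L v₀ v₀ ≈ 0.
  pair-quotient : ∀ {k} (y v : Fin (suc k) → Carrier) s →
                  pair (y ∘ Fin.suc) (quotient v) s ≈ pair y v (suc s) + φ s (v Fin.zero) * pair y v s
  pair-quotient y v s = begin
    pair y′ (quotient v) s
      ≈⟨ pair-L v₀ y′ v′ s ⟩
    pair y′ v′ (suc s) + a * pair y′ v′ s
      ≈⟨ solve 4 (λ y₀ a p q → p :+ a :* q := (y₀ :* (a :* a) :+ p) :+ a :* (y₀ :* a :+ q)) refl y₀ a _ _ ⟩
    y₀ * φ (suc s) v₀ + pair y′ v′ (suc s) + a * (y₀ * a + pair y′ v′ s)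
      ≈⟨ +-cong (pair-suc y v (suc s)) (*-congˡ (pair-suc y v s)) ⟨
    pair y v (suc s) + a * pair y v s ∎
    where
    y₀ = y Fin.zero
    v₀ = v Fin.zero
    a = φ s v₀
    y′ = y ∘ Fin.suc
    v′ = v ∘ Fin.suc

  pair-quotient-≈0 : ∀ {k} (y v : Fin (suc k) → Carrier) s → pair y v (suc s) ≈ 0# → pair y v s ≈ 0# →
                     pair (y ∘ Fin.suc) (quotient v) s ≈ 0#
  pair-quotient-≈0 y v s p q =
    trans (pair-quotient y v s) (trans (+-cong p (trans (*-congˡ q) (zeroʳ _))) (+-identityˡ _))

  -- By `pair-quotient`, equations `s` and `s + 1` combine into one for the tail of `y`. Equation
  -- `0` then fixes the first entry, and the others follow by induction on `s`.
  Indep⇒solvable : ∀ {k} (v : Fin k → Carrier) → Indep v → (b : ℕ → Carrier) →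
                   ∃ λ y → ∀ s → s ℕ.< k → pair y v s ≈ b s
  Indep⇒solvable {zero}  v _ b = (λ ()) , λ _ ()
  Indep⇒solvable {suc k} v (v₀≉0 , ind) b
    with y′ , solves ← Indep⇒solvable (quotient v) ind (λ s → b (suc s) + φ s (v Fin.zero) * b s)
    = y , correct
    where
    v₀ = v Fin.zero
    v₀⁻¹ = inv v₀ v₀≉0
    y : Fin (suc k) → Carrier
    y = ((b 0 + pair y′ (v ∘ Fin.suc) 0) * v₀⁻¹) Fun.∷ y′

    correct : ∀ s → s ℕ.< suc k → pair y v s ≈ b s
    correct zero _ = begin
      pair y v 0
        ≈⟨ pair-suc y v 0 ⟩
      (b 0 + p) * v₀⁻¹ * v₀ + p
        ≈⟨ solve 4 (λ b p i v → (b :+ p) :* i :* v :+ p := (b :+ p) :* (v :* i) :+ p) refl (b 0) p v₀⁻¹ v₀ ⟩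
      (b 0 + p) * (v₀ * v₀⁻¹) + p
        ≈⟨ +-congʳ (*-congˡ (inv-law v₀ v₀≉0)) ⟩
      (b 0 + p) * 1# + p
        ≈⟨ solve 2 (λ b p → (b :+ p) :* :1 :+ p := b) refl (b 0) p ⟩
      b 0 ∎
      where p = pair y′ (v ∘ Fin.suc) 0
    correct (suc s) (ℕ.s≤s s<k) = begin
      pair y v (suc s)
        ≈⟨ solve 2 (λ p q → p := p :+ q :+ q) refl (pair y v (suc s)) (a * pair y v s) ⟩
      pair y v (suc s) + a * pair y v s + a * pair y v s
        ≈⟨ +-cong (trans (sym (pair-quotient y v s)) (solves s s<k)) (*-congˡ (correct s (ℕₚ.m<n⇒m<1+n s<k))) ⟩
      b (suc s) + a * b s + a * b s
        ≈⟨ solve 2 (λ p q → p :+ q :+ q := p) refl (b (suc s)) (a * b s) ⟩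
      b (suc s) ∎
      where a = φ s v₀

  -- Once the pairings with `quotient v` vanish, `pair-quotient` becomes the recurrence
  -- `pair y v (suc s) = v₀^(2^s) * pair y v s`, started at zero.
  pair-vanishes-up : ∀ {k} (y v : Fin k → Carrier) → (∀ s → s ℕ.< k → pair y v s ≈ 0#) → ∀ s → pair y v s ≈ 0#
  pair-vanishes-up {zero}  y v _ s = ∑-zero _
  pair-vanishes-up {suc k} y v eq zero = eq 0 ℕ.z<s
  pair-vanishes-up {suc k} y v eq (suc s) = begin
    pair y v (suc s)
      ≈⟨ solve 2 (λ p q → p := p :+ q :+ q) refl (pair y v (suc s)) (a * pair y v s) ⟩
    pair y v (suc s) + a * pair y v s + a * pair y v s
      ≈⟨ +-cong (trans (sym (pair-quotient y v s)) (quotient≈0 s)) (*-congˡ (pair-vanishes-up y v eq s)) ⟩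
    0# + a * 0#
      ≈⟨ solve 1 (λ a → :0 :+ a :* :0 := :0) refl a ⟩
    0# ∎
    where
    a = φ s (v Fin.zero)
    quotient≈0 : ∀ s → pair (y ∘ Fin.suc) (quotient v) s ≈ 0#
    quotient≈0 = pair-vanishes-up _ _ (λ s s<k →
      pair-quotient-≈0 y v s (eq (suc s) (ℕ.s≤s s<k)) (eq s (ℕₚ.m<n⇒m<1+n s<k)))

  -- A zero `v₀` contributes nothing and is dropped. Otherwise `v₀` times the pairing at `0` is a
  -- pairing with `quotient v`, to which induction applies.
  pair-vanishes-down : ∀ {k} (y v : Fin k → Carrier) → (∀ s → s ℕ.< k → pair y v (suc s) ≈ 0#) → pair y v 0 ≈ 0#
  pair-vanishes-down {zero}  y v _ = ∑-zero _
  pair-vanishes-down {suc k} y v eq with v Fin.zero ≟ 0#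
  ... | yes v₀≈0 = trans (sym (pair-tail y v v₀≈0 0)) (pair-vanishes-down _ _ (λ s s<k →
    trans (pair-tail y v v₀≈0 (suc s)) (eq s (ℕₚ.m<n⇒m<1+n s<k))))
  ... | no v₀≉0 = x*y≈0⇒y≈0 v₀≉0 (begin
    v Fin.zero * pair y v 0                ≈⟨ +-identityˡ _ ⟨
    0# + v Fin.zero * pair y v 0           ≈⟨ +-congʳ (eq 0 ℕ.z<s) ⟨
    pair y v 1 + v Fin.zero * pair y v 0   ≈⟨ pair-quotient y v 0 ⟨
    pair (y ∘ Fin.suc) (quotient v) 0      ≈⟨ pair-vanishes-down _ _ (λ s s<k → pair-quotient-≈0 y v (suc s)
                                                (eq (suc s) (ℕ.s≤s s<k)) (eq s (ℕₚ.m<n⇒m<1+n s<k))) ⟩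
    0# ∎)

  -- If `v₀` were zero, `k` relations on the remaining `k` vectors would make the pairing at `0`
  -- vanish. With `v₀` nonzero, the hypotheses pass to `quotient v`.
  pair-bottom⇒Indep : ∀ {k} (y v : Fin (suc k) → Carrier) → ¬ (pair y v 0 ≈ 0#) →
                      (∀ s → s ℕ.< k → pair y v (suc s) ≈ 0#) → Indep v
  pair-bottom⇒Indep {k} y v p≉0 eq = v₀≉0 , rest k y v v₀≉0 p≉0 eq
    where
    v₀≉0 : ¬ (v Fin.zero ≈ 0#)
    v₀≉0 v₀≈0 = p≉0 (trans (sym (pair-tail y v v₀≈0 0)) (pair-vanishes-down _ _ (λ s s<k →
      trans (pair-tail y v v₀≈0 (suc s)) (eq s s<k))))

    rest : ∀ k (y v : Fin (suc k) → Carrier) → ¬ (v Fin.zero ≈ 0#) → ¬ (pair y v 0 ≈ 0#) →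
           (∀ s → s ℕ.< k → pair y v (suc s) ≈ 0#) → Indep (quotient v)
    rest zero    y v _ _ _ = tt
    rest (suc k) y v v₀≉0 p≉0 eq = pair-bottom⇒Indep (y ∘ Fin.suc) (quotient v)
      (λ q≈0 → p≉0 (x*y≈0⇒y≈0 v₀≉0 (begin
        v Fin.zero * pair y v 0                ≈⟨ +-identityˡ _ ⟨
        0# + v Fin.zero * pair y v 0           ≈⟨ +-congʳ (eq 0 ℕ.z<s) ⟨
        pair y v 1 + v Fin.zero * pair y v 0   ≈⟨ pair-quotient y v 0 ⟨
        pair (y ∘ Fin.suc) (quotient v) 0      ≈⟨ q≈0 ⟩
        0# ∎)))
      (λ s s<k → pair-quotient-≈0 y v (suc s) (eq (suc s) (ℕ.s≤s s<k)) (eq s (ℕₚ.m<n⇒m<1+n s<k)))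

  -- As for the bottom pairing, with vanishing propagated upwards; the top pairing survives in the
  -- quotient because the one just below it is zero.
  pair-top⇒Indep : ∀ {k} (y v : Fin (suc k) → Carrier) → ¬ (pair y v k ≈ 0#) →
                   (∀ s → s ℕ.< k → pair y v s ≈ 0#) → Indep v
  pair-top⇒Indep {k} y v p≉0 eq = v₀≉0 , rest k y v p≉0 eq
    where
    v₀≉0 : ¬ (v Fin.zero ≈ 0#)
    v₀≉0 v₀≈0 = p≉0 (trans (sym (pair-tail y v v₀≈0 k)) (pair-vanishes-up _ _ (λ s s<k →
      trans (pair-tail y v v₀≈0 s) (eq s s<k)) k))

    rest : ∀ k (y v : Fin (suc k) → Carrier) → ¬ (pair y v k ≈ 0#) →
           (∀ s → s ℕ.< k → pair y v s ≈ 0#) → Indep (quotient v)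
    rest zero    y v _ _ = tt
    rest (suc k) y v p≉0 eq = pair-top⇒Indep (y ∘ Fin.suc) (quotient v)
      (λ q≈0 → p≉0 (begin
        pair y v (suc k)                                    ≈⟨ +-identityʳ _ ⟨
        pair y v (suc k) + 0#                               ≈⟨ +-congˡ (trans (*-congˡ (eq k ℕₚ.≤-refl)) (zeroʳ _)) ⟨
        pair y v (suc k) + φ k (v Fin.zero) * pair y v k    ≈⟨ pair-quotient y v k ⟨
        pair (y ∘ Fin.suc) (quotient v) k                   ≈⟨ q≈0 ⟩
        0# ∎))
      (λ s s<k → pair-quotient-≈0 y v s (eq (suc s) (ℕ.s≤s s<k)) (eq s (ℕₚ.m<n⇒m<1+n s<k)))

  pair-φ : ∀ {k} i s (y v : Fin k → Carrier) → pair (φ i ∘ y) v (s ℕ.+ i) ≈ φ i (pair y v s)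
  pair-φ i s y v = begin
    ∑ (λ j → φ i (y j) * φ (s ℕ.+ i) (v j))  ≈⟨ ∑-cong (λ j → *-congˡ (reflexive (≡.cong (λ a → φ a (v j)) (ℕₚ.+-comm s i)))) ⟩
    ∑ (λ j → φ i (y j) * φ (i ℕ.+ s) (v j))  ≈⟨ ∑-cong (λ j → *-congˡ (φ-∘ i s (v j))) ⟨
    ∑ (λ j → φ i (y j) * φ i (φ s (v j)))    ≈⟨ ∑-cong (λ j → φ-* i (y j) (φ s (v j))) ⟨
    ∑ (λ j → φ i (y j * φ s (v j)))          ≈⟨ φ-∑ i _ ⟨
    φ i (pair y v s)                         ∎

  -- Both sides are `Σ_j y_j^(2^i) v_j^(2^s)`; this is where basis and dual exchange roles.
  pair-comm : ∀ {k} i s (y v : Fin k → Carrier) → pair (φ i ∘ y) v s ≈ pair (φ s ∘ v) y i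
  pair-comm i s y v = ∑-cong (λ j → *-comm _ _)

-- Sums over lists.

module ListSum {n} (F : FiniteField n) where
  open CharTwo F

  sumL-map-++ : ∀ {A : Set} (f : A → Carrier) xs ys →
                sumL F (map f (xs ++ ys)) ≈ sumL F (map f xs) + sumL F (map f ys)
  sumL-map-++ f []       ys = sym (+-identityˡ _)
  sumL-map-++ f (x ∷ xs) ys = trans (+-congˡ (sumL-map-++ f xs ys)) (sym (+-assoc _ _ _))

  sumL-map-cong : ∀ {A : Set} {f g : A → Carrier} → (∀ x → f x ≈ g x) → ∀ xs →
                  sumL F (map f xs) ≈ sumL F (map g xs)
  sumL-map-cong f≈g []       = refl
  sumL-map-cong f≈g (x ∷ xs) = +-cong (f≈g x) (sumL-map-cong f≈g xs)

  sumL-map-∘ : ∀ {A B : Set} (f : B → Carrier) (g : A → B) xs →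
               sumL F (map f (map g xs)) ≈ sumL F (map (f ∘ g) xs)
  sumL-map-∘ f g []       = refl
  sumL-map-∘ f g (x ∷ xs) = +-congˡ (sumL-map-∘ f g xs)

  sumL-map-+ : ∀ {A : Set} (f g : A → Carrier) xs →
               sumL F (map (λ x → f x + g x) xs) ≈ sumL F (map f xs) + sumL F (map g xs)
  sumL-map-+ f g []       = sym (+-identityˡ 0#)
  sumL-map-+ f g (x ∷ xs) = trans (+-congˡ (sumL-map-+ f g xs))
    (solve 4 (λ a b c d → (a :+ b) :+ (c :+ d) := (a :+ c) :+ (b :+ d)) refl _ _ _ _)

  *-sumL-map : ∀ {A : Set} c (f : A → Carrier) xs →
               c * sumL F (map f xs) ≈ sumL F (map (λ x → c * f x) xs)
  *-sumL-map c f []       = zeroʳ c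
  *-sumL-map c f (x ∷ xs) = trans (distribˡ _ _ _) (+-congˡ (*-sumL-map c f xs))

-- Sums of reciprocals over affine subspaces.

module AffineSums {n} (F : FiniteField n) where
  open CharTwo F
  open Determinant F using (L; quotient)
  open Independence F
  open ListSum F

  affineSum-suc : ∀ {k} f → (∀ {x y} → x ≈ y → f x ≈ f y) → ∀ a (v : Fin (suc k) → Carrier) →
    affineSum F f a v ≈ affineSum F (λ x → f x + f (x + v Fin.zero)) a (v ∘ Fin.suc)
  affineSum-suc {k} f f-cong a v = begin
    sumL F (map g (map (false ∷_) A ++ (map (true ∷_) A ++ [])))
      ≈⟨ trans (sumL-map-++ g (map (false ∷_) A) (map (true ∷_) A ++ [])) (+-congˡ (sumL-map-++ g (map (true ∷_) A) [])) ⟩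
    sumL F (map g (map (false ∷_) A)) + (sumL F (map g (map (true ∷_) A)) + 0#)
      ≈⟨ +-cong (trans (sumL-map-∘ g (false ∷_) A) (sumL-map-cong without A))
                (trans (+-identityʳ _) (trans (sumL-map-∘ g (true ∷_) A) (sumL-map-cong with-v₀ A))) ⟩
    sumL F (map (λ S → f (a + x S)) A) + sumL F (map (λ S → f (a + x S + v Fin.zero)) A)
      ≈⟨ sumL-map-+ (λ S → f (a + x S)) (λ S → f (a + x S + v Fin.zero)) A ⟨
    affineSum F (λ x → f x + f (x + v Fin.zero)) a (v ∘ Fin.suc) ∎
    where
    A = allSubsets k
    x = subsetSum F (v ∘ Fin.suc)
    g : Vec Bool (suc k) → Carrier
    g S = f (a + subsetSum F v S)

    without : ∀ S → g (false ∷ S) ≈ f (a + x S)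
    without S = f-cong (+-congˡ (+-identityˡ _))

    with-v₀ : ∀ S → g (true ∷ S) ≈ f (a + x S + v Fin.zero)
    with-v₀ S = f-cong (solve 3 (λ a v x → a :+ (v :+ x) := a :+ x :+ v) refl a (v Fin.zero) (x S))

  affineSum-quotient : ∀ {k} f → (∀ {x y} → x ≈ y → f x ≈ f y) → ∀ a (v : Fin (suc k) → Carrier) →
    affineSum F (f ∘ L (v Fin.zero)) a (v ∘ Fin.suc) ≈ affineSum F f (L (v Fin.zero) a) (quotient v)
  affineSum-quotient {k} f f-cong a v = sumL-map-cong
    (λ S → f-cong (trans (L-+ _ _ _) (+-congˡ (sym (subsetSum-quotient v S))))) (allSubsets k)

  finv-inverse : ∀ {x} → ¬ (x ≈ 0#) → x * finv F x ≈ 1#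
  finv-inverse {x} x≉0 with x ≟ 0#
  ... | yes x≈0 = contradiction x≈0 x≉0
  ... | no  x≉0 = inv-law x x≉0

  finv-0 : ∀ {x} → x ≈ 0# → finv F x ≈ 0#
  finv-0 {x} x≈0 with x ≟ 0#
  ... | yes _   = refl
  ... | no  x≉0 = contradiction x≈0 x≉0

  finv-cong : ∀ {x y} → x ≈ y → finv F x ≈ finv F y
  finv-cong {x} {y} x≈y = cases (x ≟ 0#)
    where
    cases : Dec (x ≈ 0#) → finv F x ≈ finv F y
    cases (yes x≈0) = trans (finv-0 x≈0) (sym (finv-0 (trans (sym x≈y) x≈0)))
    cases (no  x≉0) = *-cancelˡ-≉0 x≉0 (trans (finv-inverse x≉0)
      (sym (trans (*-congʳ x≈y) (finv-inverse (x≉0 ∘ trans x≈y)))))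

  isZero : Carrier → Carrier
  isZero x = ι (does (x ≟ 0#))

  isZero-0 : ∀ {x} → x ≈ 0# → isZero x ≈ 1#
  isZero-0 {x} x≈0 with x ≟ 0#
  ... | yes _   = refl
  ... | no  x≉0 = contradiction x≈0 x≉0

  isZero-≉0 : ∀ {x} → ¬ (x ≈ 0#) → isZero x ≈ 0#
  isZero-≉0 {x} x≉0 with x ≟ 0#
  ... | yes x≈0 = contradiction x≈0 x≉0
  ... | no  _   = refl

  isZero-cong : ∀ {x y} → x ≈ y → isZero x ≈ isZero y
  isZero-cong {x} {y} x≈y with x ≟ 0#
  ... | yes x≈0 = sym (isZero-0 (trans (sym x≈y) x≈0))
  ... | no  x≉0 = sym (isZero-≉0 (x≉0 ∘ trans x≈y))

  data Position (a x : Carrier) : Set where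
    at-0      : x ≈ 0# → Position a x
    at-a      : x + a ≈ 0# → ¬ (x ≈ 0#) → Position a x
    elsewhere : ¬ (x ≈ 0#) → ¬ (x + a ≈ 0#) → Position a x

  position : ∀ a x → Position a x
  position a x with x ≟ 0# | (x + a) ≟ 0#
  ... | yes x≈0 | _         = at-0 x≈0
  ... | no  x≉0 | yes x+a≈0 = at-a x+a≈0 x≉0
  ... | no  x≉0 | no  x+a≉0 = elsewhere x≉0 x+a≉0

  L-≈0ˡ : ∀ {a x} → x ≈ 0# → L a x ≈ 0#
  L-≈0ˡ x≈0 = trans (*-congʳ x≈0) (zeroˡ _)

  L-≈0ʳ : ∀ {a x} → x + a ≈ 0# → L a x ≈ 0#
  L-≈0ʳ x+a≈0 = trans (*-congˡ x+a≈0) (zeroʳ _)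

  L-≉0 : ∀ {a x} → ¬ (x ≈ 0#) → ¬ (x + a ≈ 0#) → ¬ (L a x ≈ 0#)
  L-≉0 x≉0 x+a≉0 Lx≈0 = x+a≉0 (x*y≈0⇒y≈0 x≉0 Lx≈0)

  0+a≈a : ∀ {a x} → x ≈ 0# → x + a ≈ a
  0+a≈a x≈0 = trans (+-congʳ x≈0) (+-identityˡ _)

  -- The fibre of `L a` over `0` consists of `0` and `a`, which differ, so exactly one of `x` and
  -- `x + a` is zero when `L a x` is.
  isZero-fibre : ∀ a x → ¬ (a ≈ 0#) → isZero x + isZero (x + a) ≈ isZero (L a x)
  isZero-fibre a x a≉0 with position a x
  ... | at-0 x≈0 = trans (+-cong (isZero-0 x≈0) (isZero-≉0 (a≉0 ∘ trans (sym (0+a≈a x≈0)))))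
                         (trans (+-identityʳ 1#) (sym (isZero-0 (L-≈0ˡ x≈0))))
  ... | at-a x+a≈0 x≉0 = trans (+-cong (isZero-≉0 x≉0) (isZero-0 x+a≈0))
                         (trans (+-identityˡ 1#) (sym (isZero-0 (L-≈0ʳ x+a≈0))))
  ... | elsewhere x≉0 x+a≉0 = trans (+-cong (isZero-≉0 x≉0) (isZero-≉0 x+a≉0))
                         (trans (+-identityˡ 0#) (sym (isZero-≉0 (L-≉0 x≉0 x+a≉0))))

  -- 1/x + 1/(x+a) = a/(x(x+a)), corrected where the right-hand side is a division by zero.
  finv-fibre : ∀ a x → ¬ (a ≈ 0#) →
    finv F x + finv F (x + a) ≈ a * finv F (L a x) + finv F a * isZero (L a x)
  finv-fibre a x a≉0 with position a x
  ... | at-0 x≈0 = begin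
    finv F x + finv F (x + a)
      ≈⟨ +-cong (finv-0 x≈0) (finv-cong (0+a≈a x≈0)) ⟩
    0# + finv F a
      ≈⟨ solve 2 (λ a b → :0 :+ b := a :* :0 :+ b :* :1) refl a (finv F a) ⟩
    a * 0# + finv F a * 1#
      ≈⟨ +-cong (*-congˡ (finv-0 (L-≈0ˡ x≈0))) (*-congˡ (isZero-0 (L-≈0ˡ x≈0))) ⟨
    a * finv F (L a x) + finv F a * isZero (L a x) ∎
  ... | at-a x+a≈0 x≉0 = begin
    finv F x + finv F (x + a)
      ≈⟨ +-cong (finv-cong (x+y≈0⇒x≈y x+a≈0)) (finv-0 x+a≈0) ⟩
    finv F a + 0#
      ≈⟨ solve 2 (λ a b → b :+ :0 := a :* :0 :+ b :* :1) refl a (finv F a) ⟩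
    a * 0# + finv F a * 1#
      ≈⟨ +-cong (*-congˡ (finv-0 (L-≈0ʳ x+a≈0))) (*-congˡ (isZero-0 (L-≈0ʳ x+a≈0))) ⟨
    a * finv F (L a x) + finv F a * isZero (L a x) ∎
  ... | elsewhere x≉0 x+a≉0 = *-cancelˡ-≉0 Lx≉0 (begin
    L a x * (finv F x + finv F (x + a))
      ≈⟨ solve 4 (λ x a i j → x :* (x :+ a) :* (i :+ j) := (x :* i) :* (x :+ a) :+ ((x :+ a) :* j) :* x) refl
           x a (finv F x) (finv F (x + a)) ⟩
    (x * finv F x) * (x + a) + ((x + a) * finv F (x + a)) * x
      ≈⟨ +-cong (*-congʳ (finv-inverse x≉0)) (*-congʳ (finv-inverse x+a≉0)) ⟩
    1# * (x + a) + 1# * x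
      ≈⟨ solve 3 (λ x a b → :1 :* (x :+ a) :+ :1 :* x := a :* :1 :+ b :* :0) refl x a (L a x * finv F a) ⟩
    a * 1# + L a x * finv F a * 0#
      ≈⟨ +-cong (*-congˡ (finv-inverse Lx≉0)) (*-congˡ (isZero-≉0 Lx≉0)) ⟨
    a * (L a x * finv F (L a x)) + L a x * finv F a * isZero (L a x)
      ≈⟨ solve 5 (λ l a i j z → a :* (l :* i) :+ l :* j :* z := l :* (a :* i :+ j :* z)) refl
           (L a x) a (finv F (L a x)) (finv F a) (isZero (L a x)) ⟩
    L a x * (a * finv F (L a x) + finv F a * isZero (L a x)) ∎)
    where Lx≉0 = L-≉0 x≉0 x+a≉0

  -- Evaluation at a of the polynomial ∏ (X - x) over x in the span of v.
  spanPoly : ∀ {k} → (Fin k → Carrier) → Carrier → Carrier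
  spanPoly {zero}  v a = a
  spanPoly {suc k} v a = spanPoly (quotient v) (L (v Fin.zero) a)

  spanPoly-0 : ∀ {k} (v : Fin k → Carrier) {a} → a ≈ 0# → spanPoly v a ≈ 0#
  spanPoly-0 {zero}  v a≈0 = a≈0
  spanPoly-0 {suc k} v a≈0 = spanPoly-0 (quotient v) (L-≈0ˡ a≈0)

  -- The coefficient of `X` in the polynomial of the span; by `moore-suc` it is also the Moore
  -- determinant of `v`.
  pivotProduct : ∀ {k} → (Fin k → Carrier) → Carrier
  pivotProduct {zero}  v = 1#
  pivotProduct {suc k} v = v Fin.zero * pivotProduct (quotient v)

  pivotProduct≉0 : ∀ {k} (v : Fin k → Carrier) → Indep v → ¬ (pivotProduct v ≈ 0#)
  pivotProduct≉0 {zero}  v _ eq = 0≉1 (sym eq)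
  pivotProduct≉0 {suc k} v (v₀≉0 , ind) eq = pivotProduct≉0 (quotient v) ind (x*y≈0⇒y≈0 v₀≉0 eq)

  -- The sum of 1/x over the nonzero x in the span of v.
  reciprocalSum : ∀ {k} → (Fin k → Carrier) → Carrier
  reciprocalSum {zero}  v = 0#
  reciprocalSum {suc k} v = v Fin.zero * reciprocalSum (quotient v) + finv F (v Fin.zero)

  affineSum-isZero : ∀ {k} (v : Fin k → Carrier) → Indep v → ∀ a → affineSum F isZero a v ≈ isZero (spanPoly v a)
  affineSum-isZero {zero}  v _ a = trans (+-identityʳ _) (isZero-cong (+-identityʳ a))
  affineSum-isZero {suc k} v (v₀≉0 , ind) a = begin
    affineSum F isZero a v
      ≈⟨ affineSum-suc isZero isZero-cong a v ⟩
    affineSum F (λ x → isZero x + isZero (x + v Fin.zero)) a (v ∘ Fin.suc)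
      ≈⟨ sumL-map-cong (λ S → isZero-fibre _ _ v₀≉0) (allSubsets k) ⟩
    affineSum F (isZero ∘ L (v Fin.zero)) a (v ∘ Fin.suc)
      ≈⟨ affineSum-quotient isZero isZero-cong a v ⟩
    affineSum F isZero (L (v Fin.zero) a) (quotient v)
      ≈⟨ affineSum-isZero (quotient v) ind _ ⟩
    isZero (spanPoly v a) ∎

  -- Off the span this is the logarithmic derivative `P'(a)/P(a)` of the polynomial `P` of the span.
  -- On the span `finv` kills that term and `isZero` switches on the sum over the span itself.
  affineSum-finv : ∀ {k} (v : Fin k → Carrier) → Indep v → ∀ a →
    affineSum F (finv F) a v ≈ pivotProduct v * finv F (spanPoly v a) + isZero (spanPoly v a) * reciprocalSum v
  affineSum-finv {zero} v _ a = trans (trans (+-identityʳ _) (finv-cong (+-identityʳ a)))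
    (solve 2 (λ f z → f := :1 :* f :+ z :* :0) refl (finv F a) (isZero a))
  affineSum-finv {suc k} v (v₀≉0 , ind) a = begin
    affineSum F (finv F) a v
      ≈⟨ affineSum-suc (finv F) finv-cong a v ⟩
    affineSum F (λ x → finv F x + finv F (x + v₀)) a v′
      ≈⟨ sumL-map-cong (λ S → finv-fibre v₀ _ v₀≉0) A ⟩
    affineSum F (λ x → v₀ * finv F (L v₀ x) + finv F v₀ * isZero (L v₀ x)) a v′
      ≈⟨ sumL-map-+ (λ S → v₀ * finv F (L v₀ (a + subsetSum F v′ S))) (λ S → finv F v₀ * isZero (L v₀ (a + subsetSum F v′ S))) A ⟩
    affineSum F (λ x → v₀ * finv F (L v₀ x)) a v′ + affineSum F (λ x → finv F v₀ * isZero (L v₀ x)) a v′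
      ≈⟨ +-cong (*-sumL-map v₀ (λ S → finv F (L v₀ (a + subsetSum F v′ S))) A) (*-sumL-map (finv F v₀) (λ S → isZero (L v₀ (a + subsetSum F v′ S))) A) ⟨
    v₀ * affineSum F (finv F ∘ L v₀) a v′ + finv F v₀ * affineSum F (isZero ∘ L v₀) a v′
      ≈⟨ +-cong (*-congˡ (trans (affineSum-quotient (finv F) finv-cong a v) (affineSum-finv (quotient v) ind (L v₀ a))))
                (*-congˡ (trans (affineSum-quotient isZero isZero-cong a v) (affineSum-isZero (quotient v) ind (L v₀ a)))) ⟩
    v₀ * (P * f + z * R) + finv F v₀ * z
      ≈⟨ solve 6 (λ v P f z R i → v :* (P :* f :+ z :* R) :+ i :* z := (v :* P) :* f :+ z :* (v :* R :+ i)) refl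
           v₀ P f z R (finv F v₀) ⟩
    v₀ * P * f + z * (v₀ * R + finv F v₀) ∎
    where
    A = allSubsets k
    v₀ = v Fin.zero
    v′ = v ∘ Fin.suc
    P = pivotProduct (quotient v)
    f = finv F (spanPoly v a)
    z = isZero (spanPoly v a)
    R = reciprocalSum (quotient v)

  affineSum-finv-linear : ∀ {k} (v : Fin k → Carrier) → Indep v → affineSum F (finv F) 0# v ≈ reciprocalSum v
  affineSum-finv-linear v ind = begin
    affineSum F (finv F) 0# v
      ≈⟨ affineSum-finv v ind 0# ⟩
    pivotProduct v * finv F (spanPoly v 0#) + isZero (spanPoly v 0#) * reciprocalSum v
      ≈⟨ +-cong (*-congˡ (finv-0 (spanPoly-0 v refl))) (*-congʳ (isZero-0 (spanPoly-0 v refl))) ⟩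
    pivotProduct v * 0# + 1# * reciprocalSum v
      ≈⟨ solve 2 (λ p r → p :* :0 :+ :1 :* r := r) refl (pivotProduct v) (reciprocalSum v) ⟩
    reciprocalSum v ∎

  affineSum-finv≈0⇒reciprocalSum≈0 : ∀ {k} (v : Fin k → Carrier) → Indep v → ∀ a →
    affineSum F (finv F) a v ≈ 0# → reciprocalSum v ≈ 0#
  affineSum-finv≈0⇒reciprocalSum≈0 v ind a eq with spanPoly v a ≟ 0#
  ... | yes l≈0 = begin
    reciprocalSum v
      ≈⟨ solve 2 (λ p r → r := p :* :0 :+ :1 :* r) refl (pivotProduct v) (reciprocalSum v) ⟩
    pivotProduct v * 0# + 1# * reciprocalSum v
      ≈⟨ +-cong (*-congˡ (finv-0 l≈0)) (*-congʳ (isZero-0 l≈0)) ⟨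
    pivotProduct v * finv F (spanPoly v a) + isZero (spanPoly v a) * reciprocalSum v
      ≈⟨ affineSum-finv v ind a ⟨
    affineSum F (finv F) a v
      ≈⟨ eq ⟩
    0# ∎
  ... | no l≉0 = contradiction
    (trans (sym (finv-inverse l≉0)) (trans (*-congˡ (x*y≈0⇒y≈0 (pivotProduct≉0 v ind) (begin
      pivotProduct v * finv F (spanPoly v a)
        ≈⟨ solve 2 (λ p r → p := p :+ :0 :* r) refl _ (reciprocalSum v) ⟩
      pivotProduct v * finv F (spanPoly v a) + 0# * reciprocalSum v
        ≈⟨ +-congˡ (*-congʳ (isZero-≉0 l≉0)) ⟨
      pivotProduct v * finv F (spanPoly v a) + isZero (spanPoly v a) * reciprocalSum v
        ≈⟨ trans (sym (affineSum-finv v ind a)) eq ⟩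
      0# ∎))) (zeroʳ _)))
    (0≉1 ∘ sym)

  -- Both sides satisfy the recursion defining reciprocalSum.
  ∑y²v≈c²·reciprocalSum : ∀ {k} (v y : Fin k → Carrier) c → Indep v →
    (∀ s → s ℕ.< k → pair y v s ≈ c * ι (s ℕ.≡ᵇ 0)) → pair (φ 1 ∘ y) v 0 ≈ c * c * reciprocalSum v
  ∑y²v≈c²·reciprocalSum {zero}  v y c _ _ = trans (∑-zero _) (sym (zeroʳ _))
  ∑y²v≈c²·reciprocalSum {suc k} v y c (v₀≉0 , ind) dual = *-cancelˡ-≉0 v₀≉0 (begin
    v₀ * pair (φ 1 ∘ y) v 0
      ≈⟨ *-congˡ (pair-suc (φ 1 ∘ y) v 0) ⟩
    v₀ * (y₀ * y₀ * v₀ + p)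
      ≈⟨ solve 3 (λ v y p → v :* (y :* y :* v :+ p) := (y :* v) :* (y :* v) :+ v :* p) refl v₀ y₀ p ⟩
    (y₀ * v₀) * (y₀ * v₀) + v₀ * p
      ≈⟨ +-congʳ (*-cong y₀v₀ y₀v₀) ⟩
    (c + q) * (c + q) + v₀ * p
      ≈⟨ solve 4 (λ c q v p → (c :+ q) :* (c :+ q) :+ v :* p := c :* c :+ (q :* q :+ v :* p)) refl c q v₀ p ⟩
    c * c + (q * q + v₀ * p)
      -- By Frobenius `q * q` is the pairing of the squares one level up, so together with `v₀ * p`
      -- it forms a pairing with `quotient v`.
      ≈⟨ +-congˡ (+-congʳ (pair-φ 1 0 y′ v′)) ⟨
    c * c + (pair (φ 1 ∘ y′) v′ 1 + v₀ * p)
      ≈⟨ +-congˡ (pair-L v₀ (φ 1 ∘ y′) v′ 0) ⟨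
    c * c + pair (φ 1 ∘ y′) (quotient v) 0
      ≈⟨ +-congˡ (∑y²v≈c²·reciprocalSum (quotient v) y′ (v₀ * c) ind dual′) ⟩
    c * c + v₀ * c * (v₀ * c) * R
      ≈⟨ solve 4 (λ c v R i → c :* c :+ v :* c :* (v :* c) :* R := c :* c :* :1 :+ c :* c :* (v :* (v :* R))) refl c v₀ R (finv F v₀) ⟩
    c * c * 1# + c * c * (v₀ * (v₀ * R))
      ≈⟨ +-congʳ (*-congˡ (finv-inverse v₀≉0)) ⟨
    c * c * (v₀ * finv F v₀) + c * c * (v₀ * (v₀ * R))
      ≈⟨ solve 4 (λ c v R i → c :* c :* (v :* i) :+ c :* c :* (v :* (v :* R)) := v :* (c :* c :* (v :* R :+ i))) refl c v₀ R (finv F v₀) ⟩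
    v₀ * (c * c * (v₀ * R + finv F v₀)) ∎)
    where
    v₀ = v Fin.zero
    y₀ = y Fin.zero
    v′ = v ∘ Fin.suc
    y′ = y ∘ Fin.suc
    p = pair (φ 1 ∘ y′) v′ 0
    q = pair y′ v′ 0
    R = reciprocalSum (quotient v)

    y₀v₀ : y₀ * v₀ ≈ c + q
    y₀v₀ = begin
      y₀ * v₀          ≈⟨ solve 2 (λ a q → a := a :+ q :+ q) refl (y₀ * v₀) q ⟩
      y₀ * v₀ + q + q  ≈⟨ +-congʳ (pair-suc y v 0) ⟨
      pair y v 0 + q   ≈⟨ +-congʳ (trans (dual 0 ℕ.z<s) (*-identityʳ c)) ⟩
      c + q            ∎

    -- Passing to the quotient multiplies the normalisation by `v₀`; hence the general constant `c`
    -- in the statement.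
    dual′ : ∀ s → s ℕ.< k → pair y′ (quotient v) s ≈ v₀ * c * ι (s ℕ.≡ᵇ 0)
    dual′ zero 0<k = begin
      pair y′ (quotient v) 0       ≈⟨ pair-quotient y v 0 ⟩
      pair y v 1 + v₀ * pair y v 0 ≈⟨ +-cong (dual 1 (ℕ.s≤s 0<k)) (*-congˡ (dual 0 ℕ.z<s)) ⟩
      c * 0# + v₀ * (c * 1#)       ≈⟨ solve 2 (λ c v → c :* :0 :+ v :* (c :* :1) := v :* c :* :1) refl c v₀ ⟩
      v₀ * c * 1#                  ∎
    dual′ (suc s) s<k = trans (pair-quotient-≈0 y v (suc s)
      (trans (dual (suc (suc s)) (ℕ.s≤s s<k)) (zeroʳ c))
      (trans (dual (suc s) (ℕₚ.m<n⇒m<1+n s<k)) (zeroʳ c))) (sym (zeroʳ _))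

-- Generating functions and the polynomial of a span.

-- Formal power series with coefficients in F are represented by their coefficient functions.
module Series {n} (F : FiniteField n) (K : ℕ) where
  open CharTwo F

  -- Coefficient N of z^b f(z).
  shift : ℕ → (ℕ → Carrier) → ℕ → Carrier
  shift zero    f N       = f N
  shift (suc b) f zero    = 0#
  shift (suc b) f (suc N) = shift b f N

  shift-cong : ∀ b {f g} → (∀ N → f N ≈ g N) → ∀ N → shift b f N ≈ shift b g N
  shift-cong zero    f≈g N       = f≈g N
  shift-cong (suc b) f≈g zero    = refl
  shift-cong (suc b) f≈g (suc N) = shift-cong b f≈g N

  shift-+ : ∀ b f g N → shift b (λ M → f M + g M) N ≈ shift b f N + shift b g N
  shift-+ zero    f g N       = refl
  shift-+ (suc b) f g zero    = sym (+-identityˡ 0#)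
  shift-+ (suc b) f g (suc N) = shift-+ b f g N

  shift-* : ∀ b c f N → shift b (λ M → c * f M) N ≈ c * shift b f N
  shift-* zero    c f N       = refl
  shift-* (suc b) c f zero    = sym (zeroʳ c)
  shift-* (suc b) c f (suc N) = shift-* b c f N

  shift-∑ : ∀ b {m} (f : Fin m → ℕ → Carrier) N → shift b (λ M → ∑ (λ i → f i M)) N ≈ ∑ (λ i → shift b (f i) N)
  shift-∑ zero    f N       = refl
  shift-∑ (suc b) f zero    = sym (∑-≈0 (λ i → refl))
  shift-∑ (suc b) f (suc N) = shift-∑ b f N

  shift-shift : ∀ a b f N → shift a (shift b f) N ≡ shift (a ℕ.+ b) f N
  shift-shift zero    b f N       = ≡.refl
  shift-shift (suc a) b f zero    = ≡.refl
  shift-shift (suc a) b f (suc N) = shift-shift a b f N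

  shift-comm : ∀ a b f N → shift a (shift b f) N ≡ shift b (shift a f) N
  shift-comm a b f N = ≡.trans (shift-shift a b f N)
    (≡.trans (≡.cong (λ c → shift c f N) (ℕₚ.+-comm a b)) (≡.sym (shift-shift b a f N)))

  shift-≈0 : ∀ b f N → (∀ M → N ≡ b ℕ.+ M → f M ≈ 0#) → shift b f N ≈ 0#
  shift-≈0 zero    f N       eq = eq N ≡.refl
  shift-≈0 (suc b) f zero    eq = refl
  shift-≈0 (suc b) f (suc N) eq = shift-≈0 b f N (λ M N≡b+M → eq M (≡.cong suc N≡b+M))

  shift-at-+ : ∀ b f N → shift b f (b ℕ.+ N) ≡ f N
  shift-at-+ zero    f N = ≡.refl
  shift-at-+ (suc b) f N = shift-at-+ b f N

  -- Multiplication by 1 + Σ_{i<K} (xz)^(2^i).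
  mul : Carrier → (ℕ → Carrier) → ℕ → Carrier
  mul x f N = f N + ∑ {K} (λ i → φ (toℕ i) x * shift (2 ℕ.^ toℕ i) f N)

  mul-cong : ∀ x {f g} → (∀ N → f N ≈ g N) → ∀ N → mul x f N ≈ mul x g N
  mul-cong x f≈g N = +-cong (f≈g N) (∑-cong (λ i → *-congˡ (shift-cong (2 ℕ.^ toℕ i) f≈g N)))

  mul-+ : ∀ x f g N → mul x (λ M → f M + g M) N ≈ mul x f N + mul x g N
  mul-+ x f g N = trans
    (+-congˡ (trans (∑-cong (λ i → trans (*-congˡ (shift-+ (2 ℕ.^ toℕ i) f g N)) (distribˡ _ _ _))) (∑-+ _ _)))
    (solve 4 (λ a b c d → (a :+ b) :+ (c :+ d) := (a :+ c) :+ (b :+ d)) refl _ _ _ _)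

  mul-*-shift : ∀ x c b f N → mul x (λ M → c * shift b f M) N ≈ c * shift b (mul x f) N
  mul-*-shift x c b f N = begin
    c * shift b f N + ∑ (λ i → φ (toℕ i) x * shift (2 ℕ.^ toℕ i) (λ M → c * shift b f M) N)
      ≈⟨ +-congˡ (∑-cong term) ⟩
    c * shift b f N + ∑ (λ i → c * shift b (λ M → φ (toℕ i) x * shift (2 ℕ.^ toℕ i) f M) N)
      ≈⟨ +-congˡ (*-∑ _ _) ⟨
    c * shift b f N + c * ∑ (λ i → shift b (λ M → φ (toℕ i) x * shift (2 ℕ.^ toℕ i) f M) N)
      ≈⟨ +-congˡ (*-congˡ (shift-∑ b (λ i M → φ (toℕ i) x * shift (2 ℕ.^ toℕ i) f M) N)) ⟨
    c * shift b f N + c * shift b (λ M → ∑ (λ i → φ (toℕ i) x * shift (2 ℕ.^ toℕ i) f M)) N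
      ≈⟨ trans (*-congˡ (shift-+ b _ _ N)) (distribˡ _ _ _) ⟨
    c * shift b (mul x f) N ∎
    where
    term : ∀ i → φ (toℕ i) x * shift (2 ℕ.^ toℕ i) (λ M → c * shift b f M) N
               ≈ c * shift b (λ M → φ (toℕ i) x * shift (2 ℕ.^ toℕ i) f M) N
    term i = begin
      φ (toℕ i) x * shift (2 ℕ.^ toℕ i) (λ M → c * shift b f M) N
        ≈⟨ *-congˡ (shift-* (2 ℕ.^ toℕ i) c (shift b f) N) ⟩
      φ (toℕ i) x * (c * shift (2 ℕ.^ toℕ i) (shift b f) N)
        ≈⟨ *-congˡ (*-congˡ (reflexive (shift-comm (2 ℕ.^ toℕ i) b f N))) ⟩
      φ (toℕ i) x * (c * shift b (shift (2 ℕ.^ toℕ i) f) N)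
        ≈⟨ solve 3 (λ a b c → a :* (b :* c) := b :* (a :* c)) refl _ _ _ ⟩
      c * (φ (toℕ i) x * shift b (shift (2 ℕ.^ toℕ i) f) N)
        ≈⟨ *-congˡ (shift-* b (φ (toℕ i) x) (shift (2 ℕ.^ toℕ i) f) N) ⟨
      c * shift b (λ M → φ (toℕ i) x * shift (2 ℕ.^ toℕ i) f M) N ∎

  cross : Carrier → Carrier → (ℕ → Carrier) → ℕ → Fin K → Fin K → Carrier
  cross x y f N i j = φ (toℕ i) x * φ (toℕ j) y * shift (2 ℕ.^ toℕ i) (shift (2 ℕ.^ toℕ j) f) N

  mul-mul : ∀ x y f N → mul x (mul y f) N ≈
    f N + (∑ (λ j → φ (toℕ j) y * shift (2 ℕ.^ toℕ j) f N) + ∑ (λ i → φ (toℕ i) x * shift (2 ℕ.^ toℕ i) f N))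
    + ∑ (λ i → ∑ (cross x y f N i))
  mul-mul x y f N = begin
    mul y f N + ∑ (λ i → φ (toℕ i) x * shift (2 ℕ.^ toℕ i) (mul y f) N)
      ≈⟨ +-congˡ (trans (∑-cong term) (∑-+ _ _)) ⟩
    f N + A + (B + C)
      ≈⟨ solve 4 (λ a b c d → a :+ b :+ (c :+ d) := a :+ (b :+ c) :+ d) refl (f N) A B C ⟩
    f N + (A + B) + C ∎
    where
    A B C : Carrier
    A = ∑ (λ j → φ (toℕ j) y * shift (2 ℕ.^ toℕ j) f N)
    B = ∑ (λ i → φ (toℕ i) x * shift (2 ℕ.^ toℕ i) f N)
    C = ∑ (λ i → ∑ (cross x y f N i))

    term : ∀ i → φ (toℕ i) x * shift (2 ℕ.^ toℕ i) (mul y f) N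
               ≈ φ (toℕ i) x * shift (2 ℕ.^ toℕ i) f N + ∑ (cross x y f N i)
    term i = begin
      φ (toℕ i) x * shift (2 ℕ.^ toℕ i) (mul y f) N
        ≈⟨ *-congˡ (trans (shift-+ (2 ℕ.^ toℕ i) f _ N)
             (+-congˡ (shift-∑ (2 ℕ.^ toℕ i) (λ j M → φ (toℕ j) y * shift (2 ℕ.^ toℕ j) f M) N))) ⟩
      φ (toℕ i) x * (shift (2 ℕ.^ toℕ i) f N + ∑ (λ j → shift (2 ℕ.^ toℕ i) (λ M → φ (toℕ j) y * shift (2 ℕ.^ toℕ j) f M) N))
        ≈⟨ trans (distribˡ _ _ _) (+-congˡ (*-∑ _ _)) ⟩
      φ (toℕ i) x * shift (2 ℕ.^ toℕ i) f N
        + ∑ (λ j → φ (toℕ i) x * shift (2 ℕ.^ toℕ i) (λ M → φ (toℕ j) y * shift (2 ℕ.^ toℕ j) f M) N)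
        ≈⟨ +-congˡ (∑-cong (λ j → trans (*-congˡ (shift-* (2 ℕ.^ toℕ i) (φ (toℕ j) y) (shift (2 ℕ.^ toℕ j) f) N)) (sym (*-assoc _ _ _)))) ⟩
      φ (toℕ i) x * shift (2 ℕ.^ toℕ i) f N + ∑ (cross x y f N i) ∎

  cross-comm : ∀ x y f N i j → cross x y f N i j ≈ cross y x f N j i
  cross-comm x y f N i j = *-cong (*-comm _ _) (reflexive (shift-comm (2 ℕ.^ toℕ i) (2 ℕ.^ toℕ j) f N))

  mul-comm : ∀ x y f N → mul x (mul y f) N ≈ mul y (mul x f) N
  mul-comm x y f N = trans (mul-mul x y f N) (trans
    (+-cong (+-congˡ (+-comm _ _)) (trans (∑-comm _) (∑-cong (λ j → ∑-cong (λ i → cross-comm x y f N i j)))))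
    (sym (mul-mul y x f N)))

  ∑-telescope : ∀ m (g : ℕ → Carrier) →
    ∑ {m} (λ i → g (suc (toℕ i))) ≈ ∑ {m} (λ i → g (toℕ i)) + g 0 + g m
  ∑-telescope zero g = trans (∑-zero _) (trans
    (solve 1 (λ a → :0 := :0 :+ a :+ a) refl (g 0)) (+-congʳ (+-congʳ (sym (∑-zero _)))))
  ∑-telescope (suc m) g = begin
    ∑ {suc m} (λ i → g (suc (toℕ i)))
      ≈⟨ trans (∑-suc _) (+-congˡ (∑-telescope m (g ∘ suc))) ⟩
    g 1 + (S + g 1 + g (suc m))
      ≈⟨ solve 4 (λ a b s c → b :+ (s :+ b :+ c) := a :+ s :+ a :+ c) refl (g 0) (g 1) S (g (suc m)) ⟩
    g 0 + S + g 0 + g (suc m)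
      ≈⟨ +-congʳ (+-congʳ (∑-suc _)) ⟨
    ∑ {suc m} (λ i → g (toℕ i)) + g 0 + g (suc m) ∎
    where S = ∑ {m} (λ i → g (suc (toℕ i)))

  -- With T = 1 + Σ (xz)^(2^i), squaring is additive, so T² and T differ only in their end terms.
  mul-square : ∀ x f N → mul x (mul x f) N ≈ mul x f N + (x * shift 1 f N + φ K x * shift (2 ℕ.^ K) f N)
  mul-square x f N = begin
    mul x (mul x f) N
      ≈⟨ mul-mul x x f N ⟩
    f N + (S + S) + ∑ (λ i → ∑ (cross x x f N i))
      ≈⟨ +-cong (solve 2 (λ a s → a :+ (s :+ s) := a) refl (f N) S)
                (trans (∑-symmetric (cross x x f N) (cross-comm x x f N)) (∑-cong diagonal)) ⟩
    f N + ∑ {K} (λ i → g (suc (toℕ i)))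
      ≈⟨ +-congˡ (∑-telescope K g) ⟩
    f N + (S + x * shift 1 f N + φ K x * shift (2 ℕ.^ K) f N)
      ≈⟨ solve 4 (λ a s b c → a :+ (s :+ b :+ c) := a :+ s :+ (b :+ c)) refl (f N) S _ _ ⟩
    mul x f N + (x * shift 1 f N + φ K x * shift (2 ℕ.^ K) f N) ∎
    where
    g : ℕ → Carrier
    g i = φ i x * shift (2 ℕ.^ i) f N
    S = ∑ {K} (λ i → g (toℕ i))

    diagonal : ∀ i → cross x x f N i i ≈ g (suc (toℕ i))
    diagonal i = *-congˡ (reflexive (≡.trans (shift-shift (2 ℕ.^ toℕ i) (2 ℕ.^ toℕ i) f N)
      (≡.cong (λ b → shift (2 ℕ.^ toℕ i ℕ.+ b) f N) (≡.sym (ℕₚ.+-identityʳ (2 ℕ.^ toℕ i))))))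

  -- The coefficient of `z^N` in the product over `j` of `1 + Σ_{i<K} (u_j z)^(2^i)`.
  H : ∀ {l} → (Fin l → Carrier) → ℕ → Carrier
  H {zero}  u N = ι (N ℕ.≡ᵇ 0)
  H {suc l} u   = mul (u Fin.zero) (H (u ∘ Fin.suc))

  -- What the comparison at `z^(2^k)` needs of the cofactor `G`: its constant term, and the absence
  -- of `z^(2^k - 1)`.
  record Sparse (l : ℕ) (f : ℕ → Carrier) : Set where
    field
      constant-term : f 0 ≈ 1#
      support       : ∀ N → ¬ SumOfPowers l N → f N ≈ 0#

  open Sparse

  mul-Sparse : ∀ {l f} x → Sparse l f → Sparse (suc l) (mul x f)
  mul-Sparse {l} {f} x sp = record
    { constant-term = trans (+-cong (constant-term sp) (∑-≈0 {K} (λ i → trans (*-congˡ (shift-≈0 (2 ℕ.^ toℕ i) f 0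
        (λ M 0≡2^i+M → contradiction 0≡2^i+M (ℕₚ.<⇒≢ (ℕₚ.<-≤-trans (ℕₚ.m^n>0 2 (toℕ i)) (ℕₚ.m≤m+n _ M)))))) (zeroʳ _)))) (+-identityʳ 1#)
    ; support = λ N ¬N → trans (+-cong (support sp N (¬N ∘ weaken)) (∑-≈0 {K} (λ i → trans (*-congˡ (shift-≈0 (2 ℕ.^ toℕ i) f N
        (λ { M ≡.refl → support sp M (¬N ∘ 2^i+-SumOfPowers (toℕ i)) }))) (zeroʳ _)))) (+-identityʳ 0#)
    }

  H-Sparse : ∀ {l} (u : Fin l → Carrier) → Sparse l (H u)
  H-Sparse {zero}  u = record { constant-term = refl ; support = λ { zero ¬N → contradiction none ¬N ; (suc N) _ → refl } }
  H-Sparse {suc l} u = mul-Sparse (u Fin.zero) (H-Sparse (u ∘ Fin.suc))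

  -- Multiplying H u once more by the factor of u_j squares that factor; G is the product of the others.
  H-repeated : ∀ {l} (u : Fin (suc l) → Carrier) j → ∃ λ G → Sparse l G ×
    (∀ N → mul (u j) (H u) N ≈ H u N + (u j * shift 1 G N + φ K (u j) * shift (2 ℕ.^ K) G N))
  H-repeated u Fin.zero = H (u ∘ Fin.suc) , H-Sparse (u ∘ Fin.suc) , mul-square (u Fin.zero) (H (u ∘ Fin.suc))
  H-repeated {suc l} u (Fin.suc j) with G , sp , eq ← H-repeated (u ∘ Fin.suc) j =
    mul u₀ G , mul-Sparse u₀ sp , λ N → begin
      mul x (mul u₀ H′) N
        ≈⟨ mul-comm x u₀ H′ N ⟩
      mul u₀ (mul x H′) N
        ≈⟨ mul-cong u₀ eq N ⟩
      mul u₀ (λ M → H′ M + (x * shift 1 G M + φ K x * shift (2 ℕ.^ K) G M)) N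
        ≈⟨ trans (mul-+ u₀ H′ _ N) (+-congˡ (mul-+ u₀ _ _ N)) ⟩
      mul u₀ H′ N + (mul u₀ (λ M → x * shift 1 G M) N + mul u₀ (λ M → φ K x * shift (2 ℕ.^ K) G M) N)
        ≈⟨ +-congˡ (+-cong (mul-*-shift u₀ x 1 G N) (mul-*-shift u₀ (φ K x) (2 ℕ.^ K) G N)) ⟩
      mul u₀ H′ N + (x * shift 1 (mul u₀ G) N + φ K x * shift (2 ℕ.^ K) (mul u₀ G) N) ∎
    where
    x = u (Fin.suc j)
    u₀ = u Fin.zero
    H′ = H (u ∘ Fin.suc)

-- Σ_{i<k} H_{2^k - 2^i}(u) X^(2^i) + X^(2^k) is the polynomial of the span of u.
module Dickson {n} (F : FiniteField n) where
  open CharTwo F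
  open Series F

  -- `H` at `2^k - 2^i`, with the subtraction expressed by `shift` so that it is literally a factor
  -- in a summand of `mul`.
  coefficient : ∀ {k} → (Fin k → Carrier) → ℕ → Carrier
  coefficient {k} u i = shift k (2 ℕ.^ i) (H k u) (2 ℕ.^ k)

  -- Compare `z^(2^k)` in `H-repeated`: multiplying by the factor of `u j` adds the left-hand sum to
  -- `H`, while squaring that factor adds only the two end terms.
  spanRelation : ∀ {k} (u : Fin k → Carrier) j →
                 ∑ {k} (λ i → coefficient u (toℕ i) * φ (toℕ i) (u j)) ≈ φ k (u j)
  spanRelation {suc l} u j with G , sp , eq ← H-repeated (suc l) u j = begin
    ∑ {k} (λ i → coefficient u (toℕ i) * φ (toℕ i) (u j))
      ≈⟨ ∑-cong {k} (λ i → *-comm _ _) ⟩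
    S
      ≈⟨ solve 2 (λ h s → s := h :+ (h :+ s)) refl h S ⟩
    h + mul k (u j) (H k u) (2 ℕ.^ k)
      ≈⟨ +-congˡ (eq (2 ℕ.^ k)) ⟩
    h + (h + (u j * shift k 1 G (2 ℕ.^ k) + φ k (u j) * shift k (2 ℕ.^ k) G (2 ℕ.^ k)))
      ≈⟨ +-congˡ (+-congˡ (+-cong (*-congˡ linear) (*-congˡ top))) ⟩
    h + (h + (u j * 0# + φ k (u j) * 1#))
      ≈⟨ solve 3 (λ h a b → h :+ (h :+ (a :* :0 :+ b :* :1)) := b) refl h (u j) (φ k (u j)) ⟩
    φ k (u j) ∎
    where
    k = suc l
    h = H k u (2 ℕ.^ k)
    S = ∑ {k} (λ i → φ (toℕ i) (u j) * coefficient u (toℕ i))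

    -- `z^(2^k - 1)` would need `k` powers of 2, but `G` has only `l = k - 1` factors.
    linear : shift k 1 G (2 ℕ.^ k) ≈ 0#
    linear = shift-≈0 k 1 G (2 ℕ.^ k) (λ M 2^k≡1+M →
      Sparse.support sp M (λ s → ℕₚ.1+n≰n (2^k-1-needs-k-powers k s (≡.sym 2^k≡1+M))))

    top : shift k (2 ℕ.^ k) G (2 ℕ.^ k) ≈ 1#
    top = trans (reflexive (≡.trans (≡.cong (shift k (2 ℕ.^ k) G) (≡.sym (ℕₚ.+-identityʳ (2 ℕ.^ k)))) (shift-at-+ k (2 ℕ.^ k) G 0)))
                (Sparse.constant-term sp)

  -- `2^(m+1) - 2^m = 2^m`, the number partitioned in `Λ (suc m)`.
  top-coefficient : ∀ m (u : Fin (suc m) → Carrier) → coefficient u m ≡ H (suc m) u (2 ℕ.^ m)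
  top-coefficient m u = ≡.trans
    (≡.cong (λ a → shift (suc m) (2 ℕ.^ m) (H (suc m) u) (2 ℕ.^ m ℕ.+ a)) (ℕₚ.+-identityʳ (2 ℕ.^ m)))
    (shift-at-+ (suc m) (2 ℕ.^ m) (H (suc m) u) (2 ℕ.^ m))

-- `Θ` as a coefficient of the generating function.

module ThetaFormula {n} (F : FiniteField n) where
  open CharTwo F
  open ListSum F
  open Series F

  ι-∧ : ∀ a b → ι (a ∧ b) ≈ ι a * ι b
  ι-∧ true  b = sym (*-identityˡ _)
  ι-∧ false b = sym (zeroˡ _)

  sumL-filter : ∀ {A : Set} (f : A → Carrier) p xs →
                sumL F (map f (filterᵇ p xs)) ≈ sumL F (map (λ x → ι (p x) * f x) xs)
  sumL-filter f p [] = refl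
  sumL-filter f p (x ∷ xs) with p x
  ... | true  = +-cong (sym (*-identityˡ _)) (sumL-filter f p xs)
  ... | false = trans (sumL-filter f p xs) (trans (sym (+-identityˡ _)) (+-congʳ (sym (zeroˡ _))))

  sumL-≈0 : ∀ {A : Set} {f : A → Carrier} → (∀ x → f x ≈ 0#) → ∀ xs → sumL F (map f xs) ≈ 0#
  sumL-≈0 f≈0 []       = refl
  sumL-≈0 f≈0 (x ∷ xs) = trans (+-cong (f≈0 x) (sumL-≈0 f≈0 xs)) (+-identityˡ 0#)

  sumL-comm : ∀ {A B : Set} (f : A → B → Carrier) xs ys →
    sumL F (map (λ x → sumL F (map (f x) ys)) xs) ≈ sumL F (map (λ y → sumL F (map (λ x → f x y) xs)) ys)
  sumL-comm f []       ys = sym (sumL-≈0 (λ _ → refl) ys)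
  sumL-comm f (x ∷ xs) ys = trans (+-congˡ (sumL-comm f xs ys)) (sym (sumL-map-+ (f x) _ ys))

  sumL-concatMap : ∀ {A B : Set} (f : B → Carrier) (g : A → List B) xs →
    sumL F (map f (concatMap g xs)) ≈ sumL F (map (λ x → sumL F (map f (g x))) xs)
  sumL-concatMap f g []       = refl
  sumL-concatMap f g (x ∷ xs) = trans (sumL-map-++ f (g x) (concatMap g xs)) (+-congˡ (sumL-concatMap f g xs))

  sumL-applyUpTo : ∀ (f g : ℕ → Carrier) (h : ℕ → ℕ) m → (∀ i → g i ≈ f (h i)) →
                   sumL F (map f (applyUpTo h m)) ≈ ∑ {m} (g ∘ toℕ)
  sumL-applyUpTo f g h zero    eq = sym (∑-zero _)
  sumL-applyUpTo f g h (suc m) eq =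
    trans (+-cong (sym (eq 0)) (sumL-applyUpTo f (g ∘ suc) (h ∘ suc) m (eq ∘ suc))) (sym (∑-suc _))

  sumL-upTo : ∀ (f : ℕ → Carrier) m → sumL F (map f (upTo m)) ≈ ∑ {m} (f ∘ toℕ)
  sumL-upTo f m = sumL-applyUpTo f f id m (λ _ → refl)

  sumL-allVecs : ∀ {k} B (f : Vec ℕ (suc k) → Carrier) →
    sumL F (map f (allVecs (suc k) B)) ≈ ∑ {suc B} (λ i → sumL F (map (λ α → f (toℕ i ∷ α)) (allVecs k B)))
  sumL-allVecs {k} B f = trans (sumL-concatMap f (λ x → map (x ∷_) (allVecs k B)) (upTo (suc B)))
    (trans (sumL-map-cong (λ x → sumL-map-∘ f (x ∷_) (allVecs k B)) (upTo (suc B)))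
           (sumL-upTo (λ x → sumL F (map (λ α → f (x ∷ α)) (allVecs k B))) (suc B)))

  -- The bound on the sum bounds every entry, so `σ` occurs in the list, and only once.
  allVecs-δ : ∀ {k} B (σ : Vec ℕ k) → sumℕ σ ℕ.≤ B → sumL F (map (λ l → ι (l == σ)) (allVecs k B)) ≈ 1#
  allVecs-δ B []      _   = +-identityʳ 1#
  allVecs-δ {suc k} B (a ∷ σ) a+σ≤B = begin
    sumL F (map (λ l → ι (l == (a ∷ σ))) (allVecs (suc k) B))
      ≈⟨ sumL-allVecs B (λ l → ι (l == (a ∷ σ))) ⟩
    ∑ {suc B} (λ i → sumL F (map (λ l → ι ((toℕ i ≡ᵇ a) ∧ (l == σ))) (allVecs k B)))
      ≈⟨ ∑-cong {suc B} (λ i → trans (sumL-map-cong (λ l → ι-∧ (toℕ i ≡ᵇ a) (l == σ)) (allVecs k B))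
           (trans (sym (*-sumL-map (ι (toℕ i ≡ᵇ a)) (λ l → ι (l == σ)) (allVecs k B)))
             (*-congˡ (allVecs-δ B σ (ℕₚ.≤-trans (ℕₚ.m≤n+m _ a) a+σ≤B))))) ⟩
    ∑ {suc B} (λ i → ι (toℕ i ≡ᵇ a) * 1#)
      ≈⟨ ∑-δ {suc B} (λ _ → 1#) a (ℕ.s≤s (ℕₚ.≤-trans (ℕₚ.m≤m+n a _) a+σ≤B)) ⟩
    1# ∎

  -- Each 2-adic exponent vector is a rearrangement of exactly one partition, its decreasing sort.
  Θ-as-sum : ∀ m (u : Fin (suc m) → Carrier) → Θ F (suc m) u ≈
    sumL F (map (λ α → ι (isTwoAdic (2 ℕ.^ m) α) * monomial F α u) (allVecs (suc m) (2 ℕ.^ m)))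
  Θ-as-sum m u = begin
    Θ F k u
      ≈⟨ sumL-filter (λ l → mono-sym F l u) P A ⟩
    sumL F (map (λ l → ι (P l) * mono-sym F l u) A)
      ≈⟨ sumL-map-cong inner A ⟩
    sumL F (map (λ l → sumL F (map (λ α → ι (P l ∧ isRearrangement α l) * monomial F α u) A)) A)
      ≈⟨ sumL-comm (λ l α → ι (P l ∧ isRearrangement α l) * monomial F α u) A A ⟩
    sumL F (map (λ α → sumL F (map (λ l → ι (P l ∧ isRearrangement α l) * monomial F α u) A)) A)
      ≈⟨ sumL-map-cong outer A ⟩
    sumL F (map (λ α → ι (isTwoAdic N α) * monomial F α u) A) ∎
    where
    k = suc m
    N = 2 ℕ.^ m
    A = allVecs k N
    P : Vec ℕ k → Bool
    P l = decreasing l ∧ isTwoAdic N l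

    sum-N : ∀ α → T (isTwoAdic N α) → sumℕ α ≡ N
    sum-N α t = ℕₚ.≡ᵇ⇒≡ _ _ (proj₂ (Equivalence.to (T-∧ {all zeroOrPow2 (toList α)}) t))

    inner : ∀ l → ι (P l) * mono-sym F l u ≈ sumL F (map (λ α → ι (P l ∧ isRearrangement α l) * monomial F α u) A)
    inner l with P l in eq
    ... | false = trans (zeroˡ _) (sym (sumL-≈0 (λ α → zeroˡ _) A))
    -- `mono-sym` enumerates vectors with entries up to `sumℕ l`; for a partition of `N` that list
    -- is `A`.
    ... | true  = trans (*-identityˡ _) (trans
      (reflexive (≡.cong (λ B → sumL F (map (λ α → monomial F α u) (filterᵇ (λ α → isRearrangement α l) (allVecs k B))))
        (sum-N l (proj₂ (Equivalence.to (T-∧ {decreasing l}) (Equivalence.from T-≡ eq))))))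
      (sumL-filter (λ α → monomial F α u) (λ α → isRearrangement α l) A))

    unique : ∀ α → sumL F (map (λ l → ι (isTwoAdic N α ∧ (l == sortᵛ α))) A) ≈ ι (isTwoAdic N α)
    unique α with isTwoAdic N α in eq
    ... | false = sumL-≈0 (λ _ → refl) A
    ... | true  = allVecs-δ N (sortᵛ α) (ℕₚ.≤-reflexive
      (≡.trans (≡.sym (sumℕ-↭ α (sortᵛ α) (sortᵛ-↭ α))) (sum-N α (Equivalence.from T-≡ eq))))

    outer : ∀ α → sumL F (map (λ l → ι (P l ∧ isRearrangement α l) * monomial F α u) A)
                ≈ ι (isTwoAdic N α) * monomial F α u
    outer α = begin
      sumL F (map (λ l → ι (P l ∧ isRearrangement α l) * monomial F α u) A)
        ≈⟨ sumL-map-cong (λ l → trans (*-comm _ _) (*-congˡ (reflexive (≡.cong ι (isPartition-of-sortᵛ N α l))))) A ⟩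
      sumL F (map (λ l → monomial F α u * ι (isTwoAdic N α ∧ (l == sortᵛ α))) A)
        ≈⟨ *-sumL-map (monomial F α u) (λ l → ι (isTwoAdic N α ∧ (l == sortᵛ α))) A ⟨
      monomial F α u * sumL F (map (λ l → ι (isTwoAdic N α ∧ (l == sortᵛ α))) A)
        ≈⟨ trans (*-congˡ (unique α)) (*-comm _ _) ⟩
      ι (isTwoAdic N α) * monomial F α u ∎

  isPow2⇒ : ∀ x → T (isPow2 x) → ∃ λ j → 2 ℕ.^ j ≡ x
  isPow2⇒ x t with j , p ← satisfied (any⁻ (λ j → (2 ℕ.^ j) ≡ᵇ x) (upTo (suc x)) t) = j , ℕₚ.≡ᵇ⇒≡ _ _ p

  isPow2-2^ : ∀ j → T (isPow2 (2 ℕ.^ j))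
  isPow2-2^ j = any⁺ _ (lose (∈-upTo⁺ (ℕₚ.m<n⇒m<1+n (n<2^n j))) (ℕₚ.≡⇒≡ᵇ (2 ℕ.^ j) _ ≡.refl))
    where
    n<2^n : ∀ j → j ℕ.< 2 ℕ.^ j
    n<2^n zero    = ℕ.z<s
    n<2^n (suc j) = ℕₚ.<-≤-trans (ℕ.s≤s (n<2^n j))
      (ℕₚ.≤-trans (ℕₚ.+-monoˡ-≤ (2 ℕ.^ j) (ℕₚ.m^n>0 2 j)) (ℕₚ.+-monoʳ-≤ (2 ℕ.^ j) (ℕₚ.≤-reflexive (≡.sym (ℕₚ.+-identityʳ _)))))

  -- Distinct exponents give distinct powers, so at most one indicator is `1#`; the bound on `x`
  -- keeps its exponent at most `m`.
  ι-zeroOrPow2 : ∀ m x → x ℕ.≤ 2 ℕ.^ m → ι (zeroOrPow2 x) ≈ ι (x ≡ᵇ 0) + ∑ {suc m} (λ i → ι (x ≡ᵇ 2 ℕ.^ toℕ i))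
  ι-zeroOrPow2 m zero _ = sym (trans (+-congˡ (∑-≈0 {suc m} (λ i → no-zero (toℕ i)))) (+-identityʳ 1#))
    where
    no-zero : ∀ i → ι (0 ≡ᵇ 2 ℕ.^ i) ≈ 0#
    no-zero i with 2 ℕ.^ i | ℕₚ.m^n>0 2 i
    ... | suc _ | _ = refl
  ι-zeroOrPow2 m x@(suc _) x≤2^m with isPow2 x in eq
  ... | false = sym (trans (+-identityˡ _) (∑-≈0 {suc m} (λ i → no-power (toℕ i))))
    where
    no-power : ∀ i → ι (x ≡ᵇ 2 ℕ.^ i) ≈ 0#
    no-power i with x ≡ᵇ 2 ℕ.^ i in x≡ᵇ2^i
    ... | false = refl
    ... | true  with () ← ≡.trans (≡.sym (Equivalence.to T-≡ (≡.subst (T ∘ isPow2)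
                   (≡.sym (ℕₚ.≡ᵇ⇒≡ x (2 ℕ.^ i) (Equivalence.from T-≡ x≡ᵇ2^i))) (isPow2-2^ i)))) eq
  ... | true with j , 2^j≡x ← isPow2⇒ x (Equivalence.from T-≡ eq) = sym (trans (+-identityˡ _) (begin
    ∑ {suc m} (λ i → ι (x ≡ᵇ 2 ℕ.^ toℕ i))     ≈⟨ ∑-cong {suc m} (λ i → trans (reflexive (≡.cong ι (exponent (toℕ i)))) (sym (*-identityʳ _))) ⟩
    ∑ {suc m} (λ i → ι (toℕ i ≡ᵇ j) * 1#)      ≈⟨ ∑-δ {suc m} (λ _ → 1#) j (ℕ.s≤s j≤m) ⟩
    1#                                         ∎))
    where
    j≤m : j ℕ.≤ m
    j≤m = ℕₚ.≮⇒≥ (λ m<j → ℕₚ.<⇒≱ (ℕₚ.^-monoʳ-< 2 (ℕ.s≤s (ℕ.s≤s ℕ.z≤n)) m<j) (≡.subst (ℕ._≤ 2 ℕ.^ m) (≡.sym 2^j≡x) x≤2^m))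

    2^-injective : ∀ {a b} → 2 ℕ.^ a ≡ 2 ℕ.^ b → a ≡ b
    2^-injective {a} {b} eq = ℕₚ.≤-antisym (≤ (ℕₚ.≤-reflexive eq)) (≤ (ℕₚ.≤-reflexive (≡.sym eq)))
      where
      ≤ : ∀ {a b} → 2 ℕ.^ a ℕ.≤ 2 ℕ.^ b → a ℕ.≤ b
      ≤ 2^a≤2^b = ℕₚ.≮⇒≥ (λ b<a → ℕₚ.<⇒≱ (ℕₚ.^-monoʳ-< 2 (ℕ.s≤s (ℕ.s≤s ℕ.z≤n)) b<a) 2^a≤2^b)

    exponent : ∀ i → (x ≡ᵇ 2 ℕ.^ i) ≡ (i ≡ᵇ j)
    exponent i = T-⇔⇒≡
      (λ t → ℕₚ.≡⇒≡ᵇ i j (2^-injective (≡.trans (≡.sym (ℕₚ.≡ᵇ⇒≡ x _ t)) (≡.sym 2^j≡x))))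
      (λ t → ℕₚ.≡⇒≡ᵇ x _ (≡.trans (≡.sym 2^j≡x) (≡.cong (2 ℕ.^_) (≡.sym (ℕₚ.≡ᵇ⇒≡ i j t)))))

  -- The admissible exponents `0, 2^0, ..., 2^m` are those of one factor in `mul` when `K = suc m`.
  ∑-zeroOrPow2 : ∀ m (g : ℕ → Carrier) →
    ∑ {suc (2 ℕ.^ m)} (λ x → ι (zeroOrPow2 (toℕ x)) * g (toℕ x)) ≈ g 0 + ∑ {suc m} (λ i → g (2 ℕ.^ toℕ i))
  ∑-zeroOrPow2 m g = begin
    ∑ {B} (λ x → ι (zeroOrPow2 (toℕ x)) * g (toℕ x))
      ≈⟨ ∑-cong {B} (λ x → trans (*-congʳ (ι-zeroOrPow2 m (toℕ x) (ℕₚ.≤-pred (toℕ<n x)))) (distribʳ _ _ _)) ⟩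
    ∑ {B} (λ x → ι (toℕ x ≡ᵇ 0) * g (toℕ x) + ∑ {suc m} (λ i → ι (toℕ x ≡ᵇ 2 ℕ.^ toℕ i)) * g (toℕ x))
      ≈⟨ ∑-+ {B} _ _ ⟩
    ∑ {B} (λ x → ι (toℕ x ≡ᵇ 0) * g (toℕ x)) + ∑ {B} (λ x → ∑ {suc m} (λ i → ι (toℕ x ≡ᵇ 2 ℕ.^ toℕ i)) * g (toℕ x))
      ≈⟨ +-cong (∑-δ {B} g 0 ℕ.z<s)
           (∑-cong {B} (λ x → trans (*-comm _ _) (trans (*-∑ _ _) (∑-cong {suc m} (λ i → *-comm _ _))))) ⟩
    g 0 + ∑ {B} (λ x → ∑ {suc m} (λ i → ι (toℕ x ≡ᵇ 2 ℕ.^ toℕ i) * g (toℕ x)))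
      ≈⟨ +-congˡ (∑-comm {B} {suc m} _) ⟩
    g 0 + ∑ {suc m} (λ i → ∑ {B} (λ x → ι (toℕ x ≡ᵇ 2 ℕ.^ toℕ i) * g (toℕ x)))
      ≈⟨ +-congˡ (∑-cong {suc m} (λ i → ∑-δ {B} g (2 ℕ.^ toℕ i) (ℕ.s≤s (ℕₚ.^-monoʳ-≤ 2 (ℕₚ.≤-pred (toℕ<n i)))))) ⟩
    g 0 + ∑ {suc m} (λ i → g (2 ℕ.^ toℕ i)) ∎
    where B = suc (2 ℕ.^ m)

  module _ (m : ℕ) where
    K = suc m

    monomials : ∀ {l} → (Fin l → Carrier) → ℕ → Carrier
    monomials {l} u N = sumL F (map (λ α → ι (isTwoAdic N α) * monomial F α u) (allVecs l (2 ℕ.^ m)))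

    -- Once the first exponent is `x`, the others must sum to `N - x`; for `x > N` there are none
    -- and `shift` gives zero.
    monomials-shift : ∀ {l} (u : Fin l → Carrier) x N →
      sumL F (map (λ α → ι (all zeroOrPow2 (toList α) ∧ (x ℕ.+ sumℕ α ≡ᵇ N)) * monomial F α u) (allVecs l (2 ℕ.^ m)))
        ≈ shift K x (monomials u) N
    monomials-shift u zero    N       = refl
    monomials-shift {l} u (suc x) zero = sumL-≈0 (λ α → trans (*-congʳ
      (trans (ι-∧ (all zeroOrPow2 (toList α)) false) (zeroʳ _))) (zeroˡ _)) (allVecs l (2 ℕ.^ m))
    monomials-shift u (suc x) (suc N) = monomials-shift u x N

    -- Choosing the first exponent of a vector is choosing a term of the first factor of the
    -- product.
    monomials≈H : ∀ {l} (u : Fin l → Carrier) N → monomials u N ≈ H K u N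
    monomials≈H {zero}  u zero    = trans (+-identityʳ _) (*-identityˡ 1#)
    monomials≈H {zero}  u (suc N) = trans (+-identityʳ _) (zeroˡ 1#)
    monomials≈H {suc l} u N = begin
      monomials u N
        ≈⟨ sumL-allVecs (2 ℕ.^ m) (λ α → ι (isTwoAdic N α) * monomial F α u) ⟩
      ∑ {B} (λ x → sumL F (map (λ α → ι (isTwoAdic N (toℕ x ∷ α)) * (pow F u₀ (toℕ x) * monomial F α u′)) A))
        ≈⟨ ∑-cong {B} (λ x → step (toℕ x)) ⟩
      ∑ {B} (λ x → ι (zeroOrPow2 (toℕ x)) * (pow F u₀ (toℕ x) * shift K (toℕ x) (H K u′) N))
        ≈⟨ ∑-zeroOrPow2 m (λ x → pow F u₀ x * shift K x (H K u′) N) ⟩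
      1# * H K u′ N + ∑ {K} (λ i → pow F u₀ (2 ℕ.^ toℕ i) * shift K (2 ℕ.^ toℕ i) (H K u′) N)
        ≈⟨ +-cong (*-identityˡ _) (∑-cong {K} (λ i → *-congʳ (pow-2^ (toℕ i) u₀))) ⟩
      H K u N ∎
      where
      B = suc (2 ℕ.^ m)
      A = allVecs l (2 ℕ.^ m)
      u₀ = u Fin.zero
      u′ = u ∘ Fin.suc

      step : ∀ x → sumL F (map (λ α → ι (isTwoAdic N (x ∷ α)) * (pow F u₀ x * monomial F α u′)) A)
                 ≈ ι (zeroOrPow2 x) * (pow F u₀ x * shift K x (H K u′) N)
      step x = begin
        sumL F (map (λ α → ι (isTwoAdic N (x ∷ α)) * (pow F u₀ x * monomial F α u′)) A)
          ≈⟨ sumL-map-cong (λ α → trans (*-congʳ (trans (reflexive (≡.cong ι (∧-assoc (zeroOrPow2 x) _ _)))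
               (ι-∧ (zeroOrPow2 x) _)))
               (solve 4 (λ a b c d → a :* b :* (c :* d) := a :* c :* (b :* d)) refl (ι (zeroOrPow2 x)) _ (pow F u₀ x) (monomial F α u′))) A ⟩
        sumL F (map (λ α → ι (zeroOrPow2 x) * pow F u₀ x * (ι (all zeroOrPow2 (toList α) ∧ (x ℕ.+ sumℕ α ≡ᵇ N)) * monomial F α u′)) A)
          ≈⟨ *-sumL-map (ι (zeroOrPow2 x) * pow F u₀ x) (λ α → ι (all zeroOrPow2 (toList α) ∧ (x ℕ.+ sumℕ α ≡ᵇ N)) * monomial F α u′) A ⟨
        ι (zeroOrPow2 x) * pow F u₀ x * sumL F (map (λ α → ι (all zeroOrPow2 (toList α) ∧ (x ℕ.+ sumℕ α ≡ᵇ N)) * monomial F α u′) A)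
          ≈⟨ *-assoc _ _ _ ⟩
        ι (zeroOrPow2 x) * (pow F u₀ x * sumL F (map (λ α → ι (all zeroOrPow2 (toList α) ∧ (x ℕ.+ sumℕ α ≡ᵇ N)) * monomial F α u′) A))
          ≈⟨ *-congˡ (*-congˡ (trans (monomials-shift u′ x N) (shift-cong K x (monomials≈H u′) N))) ⟩
        ι (zeroOrPow2 x) * (pow F u₀ x * shift K x (H K u′) N) ∎

  Θ≈H : ∀ m (u : Fin (suc m) → Carrier) → Θ F (suc m) u ≈ H (suc m) u (2 ℕ.^ m)
  Θ≈H m u = trans (Θ-as-sum m u) (monomials≈H m u (2 ℕ.^ m))

-- Duality between `Θ` and the reciprocal sum.

module Duality {n} (F : FiniteField n) where
  open CharTwo F
  open Independence F
  open AffineSums F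
  open Dickson F
  open ThetaFormula F using (Θ≈H)

  IsBottomDual IsTopDual : ∀ {m} → (Fin (suc m) → Carrier) → (Fin (suc m) → Carrier) → Set
  IsBottomDual {m} y v = ∀ s → s ℕ.< suc m → pair y v s ≈ ι (s ≡ᵇ 0)
  IsTopDual    {m} y v = ∀ s → s ℕ.< suc m → pair y v s ≈ ι (s ≡ᵇ m)

  φ-ι : ∀ i b → φ i (ι b) ≈ ι b
  φ-ι i true  = φ-1 i
  φ-ι i false = φ-0 i

  -- Raising the relation at level `m - t` to the power `2^t` gives every `v_j` the exponent `2^m`,
  -- whatever `t` is; the sum is then read with `y` as the basis.
  pair-flip : ∀ {k} m (y v : Fin k → Carrier) t → t ≤ m → pair (φ m ∘ v) y t ≈ φ t (pair y v (m ℕ.∸ t))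
  pair-flip m y v t t≤m = begin
    pair (φ m ∘ v) y t                ≈⟨ pair-comm m t v y ⟩
    pair (φ t ∘ y) v m                ≡⟨ ≡.cong (pair (φ t ∘ y) v) (ℕₚ.m∸n+n≡m t≤m) ⟨
    pair (φ t ∘ y) v (m ℕ.∸ t ℕ.+ t)  ≈⟨ pair-φ t (m ℕ.∸ t) y v ⟩
    φ t (pair y v (m ℕ.∸ t))          ∎

  top⇒bottom : ∀ {m} (y v : Fin (suc m) → Carrier) → IsTopDual y v → IsBottomDual (φ m ∘ v) y
  top⇒bottom {m} y v dual t (s≤s t≤m) = begin
    pair (φ m ∘ v) y t           ≈⟨ pair-flip m y v t t≤m ⟩
    φ t (pair y v (m ℕ.∸ t))     ≈⟨ φ-cong t (dual (m ℕ.∸ t) (s≤s (ℕₚ.m∸n≤m m t))) ⟩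
    φ t (ι (m ℕ.∸ t ≡ᵇ m))       ≈⟨ φ-ι t _ ⟩
    ι (m ℕ.∸ t ≡ᵇ m)             ≡⟨ ≡.cong ι (T-⇔⇒≡
      (λ p → ℕₚ.≡⇒≡ᵇ t 0 (≡.trans (≡.sym (ℕₚ.m∸[m∸n]≡n t≤m)) (≡.trans (≡.cong (m ℕ.∸_) (ℕₚ.≡ᵇ⇒≡ (m ℕ.∸ t) m p)) (ℕₚ.n∸n≡0 m))))
      (λ p → ℕₚ.≡⇒≡ᵇ _ m (≡.cong (m ℕ.∸_) (ℕₚ.≡ᵇ⇒≡ t 0 p)))) ⟩
    ι (t ≡ᵇ 0)                   ∎

  bottom⇒top : ∀ {m} (y v : Fin (suc m) → Carrier) → IsBottomDual y v → IsTopDual (φ m ∘ v) y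
  bottom⇒top {m} y v dual t (s≤s t≤m) = begin
    pair (φ m ∘ v) y t           ≈⟨ pair-flip m y v t t≤m ⟩
    φ t (pair y v (m ℕ.∸ t))     ≈⟨ φ-cong t (dual (m ℕ.∸ t) (s≤s (ℕₚ.m∸n≤m m t))) ⟩
    φ t (ι (m ℕ.∸ t ≡ᵇ 0))       ≈⟨ φ-ι t _ ⟩
    ι (m ℕ.∸ t ≡ᵇ 0)             ≡⟨ ≡.cong ι (T-⇔⇒≡
      (λ p → ℕₚ.≡⇒≡ᵇ t m (ℕₚ.≤-antisym t≤m (ℕₚ.m∸n≡0⇒m≤n (ℕₚ.≡ᵇ⇒≡ (m ℕ.∸ t) 0 p))))
      (λ p → ℕₚ.≡⇒≡ᵇ _ 0 (ℕₚ.m≤n⇒m∸n≡0 (ℕₚ.≤-reflexive (≡.sym (ℕₚ.≡ᵇ⇒≡ t m p)))))) ⟩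
    ι (t ≡ᵇ m)                   ∎

  bottomDual⇒Indep : ∀ {m} (y v : Fin (suc m) → Carrier) → IsBottomDual y v → Indep v
  bottomDual⇒Indep y v dual = pair-bottom⇒Indep y v
    (λ p≈0 → 0≉1 (trans (sym p≈0) (dual 0 ℕ.z<s))) (λ s s<m → dual (suc s) (s≤s s<m))

  topDual⇒Indep : ∀ {m} (y v : Fin (suc m) → Carrier) → IsTopDual y v → Indep v
  topDual⇒Indep {m} y v dual = pair-top⇒Indep y v
    (λ p≈0 → 0≉1 (trans (sym p≈0) (trans (dual m ℕₚ.≤-refl) (reflexive (≡.cong ι (T-⇔⇒≡ {y = true} _ (λ _ → ℕₚ.≡⇒≡ᵇ m m ≡.refl)))))))
    (λ s s<m → trans (dual s (ℕₚ.m<n⇒m<1+n s<m)) (reflexive (≡.cong ι (T-⇔⇒≡ {y = false} (λ p → ℕₚ.<⇒≢ s<m (ℕₚ.≡ᵇ⇒≡ s m p)) (λ ())))))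

  -- Substitute `spanRelation` for each `u_j^(2^k)` and exchange the sums: the top dual `z` selects
  -- the coefficient with index `m`.
  Θ≈pair : ∀ {m} (z u : Fin (suc m) → Carrier) → IsTopDual z u → Θ F (suc m) u ≈ pair z u (suc m)
  Θ≈pair {m} z u dual = sym (begin
    pair z u k
      ≈⟨ ∑-cong (λ j → *-congˡ (spanRelation u j)) ⟨
    ∑ (λ j → z j * ∑ {k} (λ i → coefficient u (toℕ i) * φ (toℕ i) (u j)))
      ≈⟨ ∑-cong (λ j → trans (*-∑ _ _) (∑-cong {k} (λ i →
           solve 3 (λ a b c → a :* (b :* c) := b :* (a :* c)) refl (z j) (coefficient u (toℕ i)) (φ (toℕ i) (u j))))) ⟩
    ∑ (λ j → ∑ {k} (λ i → coefficient u (toℕ i) * (z j * φ (toℕ i) (u j))))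
      ≈⟨ trans (∑-comm _) (∑-cong {k} (λ i → sym (*-∑ (coefficient u (toℕ i)) (λ j → z j * φ (toℕ i) (u j))))) ⟩
    ∑ {k} (λ i → coefficient u (toℕ i) * pair z u (toℕ i))
      ≈⟨ ∑-cong {k} (λ i → trans (*-congˡ (dual (toℕ i) (toℕ<n i))) (*-comm _ _)) ⟩
    ∑ {k} (λ i → ι (toℕ i ≡ᵇ m) * coefficient u (toℕ i))
      ≈⟨ ∑-δ {k} (coefficient u) m ℕₚ.≤-refl ⟩
    coefficient u m
      ≈⟨ trans (reflexive (top-coefficient m u)) (sym (Θ≈H m u)) ⟩
    Θ F k u ∎)
    where k = suc m

  reciprocalSum≈pair : ∀ {m} (y v : Fin (suc m) → Carrier) → Indep v → IsBottomDual y v →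
                       pair (φ 1 ∘ y) v 0 ≈ reciprocalSum v
  reciprocalSum≈pair y v ind dual = trans
    (∑y²v≈c²·reciprocalSum v y 1# ind (λ s s<k → trans (dual s s<k) (sym (*-identityˡ _))))
    (solve 1 (λ r → :1 :* :1 :* r := r) refl (reciprocalSum v))

  -- `φ m ∘ u` is a bottom dual of `v`, and its squares `u_j^(2^(m+1))` turn the reciprocal sum into
  -- the pairing of `Θ≈pair`.
  reciprocalSum-topDual : ∀ {m} (v u : Fin (suc m) → Carrier) → IsTopDual v u → reciprocalSum v ≈ Θ F (suc m) u
  reciprocalSum-topDual {m} v u dual = begin
    reciprocalSum v                ≈⟨ reciprocalSum≈pair (φ m ∘ u) v (bottomDual⇒Indep _ v dual′) dual′ ⟨
    pair (φ (suc m) ∘ u) v 0       ≈⟨ pair-comm (suc m) 0 u v ⟩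
    pair v u (suc m)               ≈⟨ Θ≈pair v u dual ⟨
    Θ F (suc m) u                  ∎
    where dual′ = top⇒bottom v u dual

  -- Both sides equal `Σ_j v_j^(2^m) y_j^(2^(m+1))`, which is `φ m` of the sum of the `y_j² v_j`; no
  -- root of Frobenius is taken.
  Θ-bottomDual : ∀ {m} (y v : Fin (suc m) → Carrier) → Indep v → IsBottomDual y v →
                 Θ F (suc m) y ≈ φ m (reciprocalSum v)
  Θ-bottomDual {m} y v ind dual = begin
    Θ F (suc m) y                       ≈⟨ Θ≈pair (φ m ∘ v) y (bottom⇒top y v dual) ⟩
    pair (φ m ∘ v) y (suc m)            ≈⟨ pair-comm m (suc m) v y ⟩
    pair (φ (suc m) ∘ y) v m            ≈⟨ ∑-cong (λ j → *-congʳ (φ-* m (y j) (y j))) ⟨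
    pair (φ m ∘ φ 1 ∘ y) v m            ≈⟨ pair-φ m 0 (φ 1 ∘ y) v ⟩
    φ m (pair (φ 1 ∘ y) v 0)            ≈⟨ φ-cong m (reciprocalSum≈pair y v ind dual) ⟩
    φ m (reciprocalSum v)               ∎

-- Exhaustive search for a witness.

module Search {n} (F : FiniteField n) where
  open CharTwo F
  open Determinant F using (det-cong)
  open ListSum F

  pow-cong : ∀ a {x y} → x ≈ y → pow F x a ≈ pow F y a
  pow-cong zero    x≈y = refl
  pow-cong (suc a) x≈y = *-cong x≈y (pow-cong a x≈y)

  moore-cong : ∀ {k} {u v : Fin k → Carrier} → (∀ i → u i ≈ v i) → moore F u ≈ moore F v
  moore-cong u≈v = det-cong (λ i j → pow-cong (2 ℕ.^ toℕ i) (u≈v j))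

  monomial-cong : ∀ {k} (α : Vec ℕ k) {u v} → (∀ i → u i ≈ v i) → monomial F α u ≈ monomial F α v
  monomial-cong []      u≈v = refl
  monomial-cong (a ∷ α) u≈v = *-cong (pow-cong a (u≈v Fin.zero)) (monomial-cong α (u≈v ∘ Fin.suc))

  Θ-cong : ∀ k {u v : Fin k → Carrier} → (∀ i → u i ≈ v i) → Θ F k u ≈ Θ F k v
  Θ-cong k u≈v = sumL-map-cong (λ l → sumL-map-cong (λ α → monomial-cong α u≈v)
    (filterᵇ (λ α → isRearrangement α l) (allVecs k (sumℕ l)))) (Λ k)

  -- The field is enumerated only up to `≈`, so the predicate must respect `≈` pointwise; this is
  -- what the congruence lemmas supply.
  ∃? : ∀ k (P : (Fin k → Carrier) → Set) → (∀ u → Dec (P u)) →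
       (∀ {u v} → (∀ i → u i ≈ v i) → P u → P v) → Dec (∃ P)
  ∃? zero P P? resp with P? (λ ())
  ... | yes p = yes (_ , p)
  ... | no ¬p = no (λ (u , p) → ¬p (resp (λ ()) p))
  ∃? (suc k) P P? resp with any? (λ i → ∃? k (λ u → P (fromFin i Fun.∷ u)) (λ u → P? (fromFin i Fun.∷ u))
                             (λ u≈v → resp λ { Fin.zero → refl ; (Fin.suc j) → u≈v j }))
  ... | yes (i , u , p) = yes (_ , p)
  ... | no ¬p = no (λ (u , p) → ¬p (toFin (u Fin.zero) , u ∘ Fin.suc ,
    resp (λ { Fin.zero → sym (from∘to _) ; (Fin.suc j) → refl }) p))

  Witness : ∀ k → (Fin k → Carrier) → Set
  Witness k u = ¬ (moore F u ≈ 0#) × Θ F k u ≈ 0#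

  witness? : ∀ k → Dec (∃ (Witness k))
  witness? k = ∃? k (Witness k) (λ u → ¬? (moore F u ≟ 0#) ×-dec (Θ F k u ≟ 0#))
    (λ u≈v (m≉0 , θ≈0) → (λ m≈0 → m≉0 (trans (moore-cong u≈v) m≈0)) , trans (sym (Θ-cong k u≈v)) θ≈0)

theorem3p11 : (n k : ℕ) → 1 ≤ n → 1 ≤ k → (F : FiniteField n) →
    (¬ SumFree F k (finv F)) ⇔
    (∃ λ (u : Fin k → FiniteField.Carrier F) →
    ¬ (FiniteField._≈_ F (moore F u) (FiniteField.0# F)) ×
    FiniteField._≈_ F (Θ F k u) (FiniteField.0# F))
theorem3p11 n k@(suc m) _ _ F = mk⇔ ⇒ ⇐
  where
  open CharTwo F
  open Independence F
  open AffineSums F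
  open Duality F
  open Search F

  ⇒ : ¬ SumFree F k (finv F) → ∃ (Witness k)
  ⇒ ¬sumFree with witness? k
  ... | yes w = w
  ... | no ¬w = contradiction sumFree ¬sumFree
    where
    sumFree : SumFree F k (finv F)
    sumFree a v lin sum≈0
      with ind ← LinIndep⇒Indep v lin
      with y , dual ← Indep⇒solvable v ind (λ s → ι (s ≡ᵇ 0))
      -- The witness is the dual `y`, not the basis `v` itself; it is independent because `φ m ∘ v`
      -- is a top dual of it.
      = ¬w (y , Indep⇒moore≉0 y (topDual⇒Indep _ y (bottom⇒top y v dual)) , (begin
          Θ F k y                ≈⟨ Θ-bottomDual y v ind dual ⟩
          φ m (reciprocalSum v)  ≈⟨ φ-cong m (affineSum-finv≈0⇒reciprocalSum≈0 v ind a sum≈0) ⟩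
          φ m 0#                 ≈⟨ φ-0 m ⟩
          0#                     ∎))

  ⇐ : ∃ (Witness k) → ¬ SumFree F k (finv F)
  ⇐ (u , m≉0 , θ≈0) sumFree =
    -- The top dual `v` of `u` spans the subspace with vanishing sum; as that subspace is linear,
    -- the base point is `0#`.
    let v , dual = Indep⇒solvable u (moore≉0⇒Indep u m≉0) (λ s → ι (s ≡ᵇ m))
        ind = bottomDual⇒Indep _ v (top⇒bottom v u dual)
    in sumFree 0# v (Indep⇒LinIndep v ind) (begin
      affineSum F (finv F) 0# v  ≈⟨ affineSum-finv-linear v ind ⟩
      reciprocalSum v            ≈⟨ reciprocalSum-topDual v u dual ⟩
      Θ F k u                    ≈⟨ θ≈0 ⟩
      0#                         ∎)
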